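{- Let $g$ be a positive integer, and let $\mathcal{A}=\{a_1<a_2<\cdots\}$, with $0\le a_1$, be an infinite $g$-Golomb ruler (elements listed in increasing order). Then $$\limsup_{n\to\infty} \frac{a_n}{n^2\log n} \ge \frac{\log 2}{2g}.$$
   Context: For a positive integer $g$, a set $\mathcal{A}$ of nonnegative integers is a $g$-Golomb ruler if for each integer $d>0$ there are at most $g$ pairs $(a,b)\in\mathcal{A}\times\mathcal{A}$ with $d=a-b$. Here $\log$ is the natural logarithm, and the limsup is taken in the extended reals (it may be $+\infty$). -}

module Defs where

open import Data.Integer.Base as ℤ using (+_)
import Data.Integer.Properties as ℤ
open import Data.List.Base using (List; length)
open import Data.List.Relation.Unary.All using (All)
open import Data.List.Relation.Unary.Unique.Propositional using (Unique)
open import Data.Nat.Base as ℕ using (ℕ; zero; suc; pred; NonZero; NonTrivial)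
import Data.Nat.Properties as ℕ
open import Data.Nat.Tactic.RingSolver using (solve-∀)
open import Data.Product using (∃; _×_; _,_; proj₁; proj₂)
open import Data.Rational.Base as ℚ using (ℚ; 0ℚ; 1ℚ; toℚᵘ; ∣_∣)
import Data.Rational.Properties as ℚ
open import Data.Rational.Solver using (module +-*-Solver)
import Data.Rational.Unnormalised.Base as ℚᵘ
import Data.Rational.Unnormalised.Properties as ℚᵘ
open import Data.Sum.Base using (inj₁; inj₂)
open import Level using (0ℓ)
open import Relation.Binary.PropositionalEquality
open import Relation.Unary using (Pred; _∈_)

------------------------------------------------------------------------
-- Golomb rulers

-- "At most g pairs" is rendered as: every duplicate-free list of such
-- pairs has length at most g.
IsGolombRuler : ℕ → Pred ℕ 0ℓ → Set
IsGolombRuler g A =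
  ∀ d → 0 ℕ.< d → (ps : List (ℕ × ℕ)) → Unique ps →
  All (λ p → proj₁ p ∈ A × proj₂ p ∈ A × proj₁ p ≡ d ℕ.+ proj₂ p) ps →
  length ps ℕ.≤ g

-- Indexing starts at 0: a (pred n) is the n-th smallest element of A.
record IsIncreasingEnumeration (A : Pred ℕ 0ℓ) (a : ℕ → ℕ) : Set where
  field
    increasing : ∀ {i j} → i ℕ.< j → a i ℕ.< a j
    sound      : ∀ i → a i ∈ A
    complete   : ∀ {x} → x ∈ A → ∃ λ i → a i ≡ x

------------------------------------------------------------------------
-- Rational arithmetic

0<½ : 0ℚ ℚ.< ℚ.½
0<½ = ℚ.*<* (ℤ.+<+ (ℕ.s≤s ℕ.z≤n))

*-0< : ∀ {p q} → 0ℚ ℚ.< p → 0ℚ ℚ.< q → 0ℚ ℚ.< p ℚ.* q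
*-0< {p} {q} 0<p 0<q =
  ℚ.positive⁻¹ _ {{ℚ.pos*pos⇒pos p {{ℚ.positive 0<p}} q {{ℚ.positive 0<q}}}}

*-mono : ∀ {p q r s} → 0ℚ ℚ.≤ p → 0ℚ ℚ.≤ s → p ℚ.≤ q → r ℚ.≤ s →
         p ℚ.* r ℚ.≤ q ℚ.* s
*-mono {p} {q} {r} {s} 0≤p 0≤s p≤q r≤s = ℚ.≤-trans
  (ℚ.*-monoˡ-≤-nonNeg p {{ℚ.nonNegative 0≤p}} r≤s)
  (ℚ.*-monoʳ-≤-nonNeg s {{ℚ.nonNegative 0≤s}} p≤q)

1/-0< : ∀ {p} (0<p : 0ℚ ℚ.< p) → 0ℚ ℚ.< (ℚ.1/ p) {{ℚ.>-nonZero 0<p}}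
1/-0< {p} 0<p = ℚ.positive⁻¹ _ {{ℚ.1/pos⇒pos p {{ℚ.positive 0<p}}}}

0<p+1 : ∀ {p} → 0ℚ ℚ.≤ p → 0ℚ ℚ.< p ℚ.+ 1ℚ
0<p+1 {p} 0≤p = ℚ.<-≤-trans {j = 1ℚ} (ℚ.*<* (ℤ.+<+ (ℕ.s≤s ℕ.z≤n)))
  (subst (ℚ._≤ p ℚ.+ 1ℚ) (ℚ.+-identityˡ 1ℚ) (ℚ.+-monoˡ-≤ 1ℚ 0≤p))

∣∣-bound : ∀ {p q e} → p ℚ.≤ q ℚ.+ e → q ℚ.≤ p ℚ.+ e → ∣ p ℚ.- q ∣ ℚ.≤ e
∣∣-bound {p} {q} {e} p≤q+e q≤p+e with ℚ.∣p∣≡p∨∣p∣≡-p (p ℚ.- q)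
... | inj₁ eq = subst₂ ℚ._≤_ (sym eq)
  (solve 2 (λ q e → q :+ e :- q := e) refl q e)
  (ℚ.+-monoˡ-≤ (ℚ.- q) p≤q+e)
  where open +-*-Solver
... | inj₂ eq = subst₂ ℚ._≤_
  (trans (solve 2 (λ p q → q :- p := :- (p :- q)) refl p q) (sym eq))
  (solve 2 (λ p e → p :+ e :- p := e) refl p e)
  (ℚ.+-monoˡ-≤ (ℚ.- p) q≤p+e)
  where open +-*-Solver

product-difference : ∀ x₁ x₂ y₁ y₂ →
  ∣ x₁ ℚ.* y₁ ℚ.- x₂ ℚ.* y₂ ∣ ℚ.≤ ∣ x₁ ∣ ℚ.* ∣ y₁ ℚ.- y₂ ∣ ℚ.+ ∣ x₁ ℚ.- x₂ ∣ ℚ.* ∣ y₂ ∣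
product-difference x₁ x₂ y₁ y₂ = begin
  ∣ x₁ ℚ.* y₁ ℚ.- x₂ ℚ.* y₂ ∣
    ≡⟨ cong ∣_∣ (solve 4 (λ x₁ x₂ y₁ y₂ →
         x₁ :* y₁ :- x₂ :* y₂ := x₁ :* (y₁ :- y₂) :+ (x₁ :- x₂) :* y₂) refl x₁ x₂ y₁ y₂) ⟩
  ∣ x₁ ℚ.* (y₁ ℚ.- y₂) ℚ.+ (x₁ ℚ.- x₂) ℚ.* y₂ ∣
    ≤⟨ ℚ.∣p+q∣≤∣p∣+∣q∣ (x₁ ℚ.* (y₁ ℚ.- y₂)) ((x₁ ℚ.- x₂) ℚ.* y₂) ⟩
  ∣ x₁ ℚ.* (y₁ ℚ.- y₂) ∣ ℚ.+ ∣ (x₁ ℚ.- x₂) ℚ.* y₂ ∣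
    ≡⟨ cong₂ ℚ._+_ (ℚ.∣p*q∣≡∣p∣*∣q∣ x₁ (y₁ ℚ.- y₂)) (ℚ.∣p*q∣≡∣p∣*∣q∣ (x₁ ℚ.- x₂) y₂) ⟩
  ∣ x₁ ∣ ℚ.* ∣ y₁ ℚ.- y₂ ∣ ℚ.+ ∣ x₁ ℚ.- x₂ ∣ ℚ.* ∣ y₂ ∣ ∎
  where open ℚ.≤-Reasoning
        open +-*-Solver

regroup : ∀ B C B′ C′ e →
  B ℚ.* (e ℚ.* B′) ℚ.+ e ℚ.* C′ ℚ.* C ≡ e ℚ.* (B ℚ.* B′) ℚ.+ e ℚ.* (C ℚ.* C′)
regroup = solve 5 (λ B C B′ C′ e →
  B :* (e :* B′) :+ e :* C′ :* C := e :* (B :* B′) :+ e :* (C :* C′)) refl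
  where open +-*-Solver

halves : ∀ ε B C B′ C′ → B ℚ.* B′ ≡ 1ℚ → C ℚ.* C′ ≡ 1ℚ →
  B ℚ.* (ε ℚ.* ℚ.½ ℚ.* B′) ℚ.+ ε ℚ.* ℚ.½ ℚ.* C′ ℚ.* C ≡ ε
halves ε B C B′ C′ BB′≡1 CC′≡1 = begin
  B ℚ.* (ε ℚ.* ℚ.½ ℚ.* B′) ℚ.+ ε ℚ.* ℚ.½ ℚ.* C′ ℚ.* C
    ≡⟨ regroup B C B′ C′ (ε ℚ.* ℚ.½) ⟩
  ε ℚ.* ℚ.½ ℚ.* (B ℚ.* B′) ℚ.+ ε ℚ.* ℚ.½ ℚ.* (C ℚ.* C′)
    ≡⟨ cong₂ (λ u v → ε ℚ.* ℚ.½ ℚ.* u ℚ.+ ε ℚ.* ℚ.½ ℚ.* v) BB′≡1 CC′≡1 ⟩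
  ε ℚ.* ℚ.½ ℚ.* 1ℚ ℚ.+ ε ℚ.* ℚ.½ ℚ.* 1ℚ
    ≡⟨ solve 1 (λ ε → ε :* con ℚ.½ :* con 1ℚ :+ ε :* con ℚ.½ :* con 1ℚ := ε) refl ε ⟩
  ε ∎
  where open ≡-Reasoning
        open +-*-Solver

------------------------------------------------------------------------
-- Real numbers as Cauchy sequences of rationals

EventuallyWithin : ℚ → (ℕ → ℚ) → Set
EventuallyWithin ε x = ∃ λ N → ∀ m n → N ℕ.≤ m → N ℕ.≤ n → ∣ x m ℚ.- x n ∣ ℚ.< ε

record ℝ : Set where
  no-eta-equality
  constructor mkℝ
  field
    seq    : ℕ → ℚ
    cauchy : ∀ ε → 0ℚ ℚ.< ε → EventuallyWithin ε seq

open ℝ public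

fromℚ : ℚ → ℝ
fromℚ q .seq _ = q
fromℚ q .cauchy ε 0<ε = 0 , λ _ _ _ _ →
  subst (ℚ._< ε) (cong ∣_∣ (sym (ℚ.+-inverseʳ q))) 0<ε

-- Defined by copatterns, so that instance search can match on fromℕ.
fromℕ : ℕ → ℝ
fromℕ n .seq _  = + n ℚ./ 1
fromℕ n .cauchy = cauchy (fromℚ (+ n ℚ./ 1))

0ℝ : ℝ
0ℝ = fromℚ 0ℚ

infix 4 _<_
record _<_ (x y : ℝ) : Set where
  constructor mk<
  field
    gap      : ℚ
    gap-pos  : 0ℚ ℚ.< gap
    index    : ℕ
    separate : ∀ n → index ℕ.≤ n → seq x n ℚ.+ gap ℚ.≤ seq y n

BoundedBy : ℚ → (ℕ → ℚ) → Set
BoundedBy B x = ∃ λ N → ∀ n → N ℕ.≤ n → ∣ x n ∣ ℚ.≤ B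

∣∣-close : ∀ {u v e} → ∣ u ℚ.- v ∣ ℚ.< e → ∣ u ∣ ℚ.≤ ∣ v ∣ ℚ.+ e
∣∣-close {u} {v} {e} close = begin
  ∣ u ∣                      ≡⟨ cong ∣_∣ (solve 2 (λ u v → u := v :+ (u :- v)) refl u v) ⟩
  ∣ v ℚ.+ (u ℚ.- v) ∣        ≤⟨ ℚ.∣p+q∣≤∣p∣+∣q∣ v (u ℚ.- v) ⟩
  ∣ v ∣ ℚ.+ ∣ u ℚ.- v ∣      ≤⟨ ℚ.+-monoʳ-≤ ∣ v ∣ (ℚ.<⇒≤ close) ⟩
  ∣ v ∣ ℚ.+ e                ∎
  where open ℚ.≤-Reasoning
        open +-*-Solver

bounded : ∀ x → ∃ λ B → 0ℚ ℚ.< B × BoundedBy B (seq x)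
bounded x =
  let N , close = cauchy x 1ℚ (ℚ.*<* (ℤ.+<+ (ℕ.s≤s ℕ.z≤n)))
  in ∣ seq x N ∣ ℚ.+ 1ℚ , 0<p+1 (ℚ.0≤∣p∣ (seq x N)) , N ,
     λ n N≤n → ∣∣-close (close n N N≤n ℕ.≤-refl)

*-cauchy : ∀ {x y B C B′ C′ ε} → BoundedBy B x → BoundedBy C y →
  0ℚ ℚ.< B → 0ℚ ℚ.< C → B ℚ.* B′ ≡ 1ℚ → C ℚ.* C′ ≡ 1ℚ →
  EventuallyWithin (ε ℚ.* ℚ.½ ℚ.* C′) x → EventuallyWithin (ε ℚ.* ℚ.½ ℚ.* B′) y →
  EventuallyWithin ε (λ n → x n ℚ.* y n)
*-cauchy {x} {y} {B} {C} {B′} {C′} {ε} (N₁ , ∣x∣≤B) (N₂ , ∣y∣≤C)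
  0<B 0<C BB′≡1 CC′≡1 (N₃ , closeˣ) (N₄ , closeʸ) =
  N₁ ℕ.⊔ N₂ ℕ.⊔ (N₃ ℕ.⊔ N₄) , λ m n N≤m N≤n →
    let x₁ = x m ; x₂ = x n ; y₁ = y m ; y₂ = y n in begin-strict
      ∣ x₁ ℚ.* y₁ ℚ.- x₂ ℚ.* y₂ ∣
        ≤⟨ product-difference x₁ x₂ y₁ y₂ ⟩
      ∣ x₁ ∣ ℚ.* ∣ y₁ ℚ.- y₂ ∣ ℚ.+ ∣ x₁ ℚ.- x₂ ∣ ℚ.* ∣ y₂ ∣
        ≤⟨ ℚ.+-mono-≤
             (*-mono (ℚ.0≤∣p∣ x₁) (ℚ.0≤∣p∣ (y₁ ℚ.- y₂))
               (∣x∣≤B m (ℕ.≤-trans (ℕ.m≤m⊔n N₁ N₂) (⊔₁ N≤m))) ℚ.≤-refl)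
             (*-mono (ℚ.0≤∣p∣ (x₁ ℚ.- x₂)) (ℚ.<⇒≤ 0<C) ℚ.≤-refl
               (∣y∣≤C n (ℕ.≤-trans (ℕ.m≤n⊔m N₁ N₂) (⊔₁ N≤n)))) ⟩
      B ℚ.* ∣ y₁ ℚ.- y₂ ∣ ℚ.+ ∣ x₁ ℚ.- x₂ ∣ ℚ.* C
        <⟨ ℚ.+-mono-<
             (ℚ.*-monoʳ-<-pos B {{ℚ.positive 0<B}} (closeʸ m n (⊔₄ N≤m) (⊔₄ N≤n)))
             (ℚ.*-monoˡ-<-pos C {{ℚ.positive 0<C}} (closeˣ m n (⊔₃ N≤m) (⊔₃ N≤n))) ⟩
      B ℚ.* (ε ℚ.* ℚ.½ ℚ.* B′) ℚ.+ ε ℚ.* ℚ.½ ℚ.* C′ ℚ.* C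
        ≡⟨ halves ε B C B′ C′ BB′≡1 CC′≡1 ⟩
      ε ∎
  where
    open ℚ.≤-Reasoning
    ⊔₁ : ∀ {k} → N₁ ℕ.⊔ N₂ ℕ.⊔ (N₃ ℕ.⊔ N₄) ℕ.≤ k → N₁ ℕ.⊔ N₂ ℕ.≤ k
    ⊔₁ = ℕ.m⊔n≤o⇒m≤o _ _
    ⊔₃ : ∀ {k} → N₁ ℕ.⊔ N₂ ℕ.⊔ (N₃ ℕ.⊔ N₄) ℕ.≤ k → N₃ ℕ.≤ k
    ⊔₃ N≤k = ℕ.m⊔n≤o⇒m≤o N₃ N₄ (ℕ.m⊔n≤o⇒n≤o (N₁ ℕ.⊔ N₂) _ N≤k)
    ⊔₄ : ∀ {k} → N₁ ℕ.⊔ N₂ ℕ.⊔ (N₃ ℕ.⊔ N₄) ℕ.≤ k → N₄ ℕ.≤ k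
    ⊔₄ N≤k = ℕ.m⊔n≤o⇒n≤o N₃ N₄ (ℕ.m⊔n≤o⇒n≤o (N₁ ℕ.⊔ N₂) _ N≤k)

infixl 7 _*_ _÷_

_*_ : ℝ → ℝ → ℝ
(x * y) .seq n = seq x n ℚ.* seq y n
(x * y) .cauchy ε 0<ε =
  let B , 0<B , ∣x∣≤B = bounded x
      C , 0<C , ∣y∣≤C = bounded y
      ε/2 = ε ℚ.* ℚ.½
      0<ε/2 = *-0< 0<ε 0<½
  in *-cauchy ∣x∣≤B ∣y∣≤C 0<B 0<C
       (ℚ.*-inverseʳ B {{ℚ.>-nonZero 0<B}}) (ℚ.*-inverseʳ C {{ℚ.>-nonZero 0<C}})
       (cauchy x (ε/2 ℚ.* (ℚ.1/ C) {{ℚ.>-nonZero 0<C}}) (*-0< 0<ε/2 (1/-0< 0<C)))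
       (cauchy y (ε/2 ℚ.* (ℚ.1/ B) {{ℚ.>-nonZero 0<B}}) (*-0< 0<ε/2 (1/-0< 0<B)))

-- The sequence of y is reindexed past the point from which it stays
-- above the gap, so that all its terms are invertible.
module Reciprocal (y : ℝ) (0<y : 0ℝ < y) where

  open _<_ 0<y renaming (gap to δ; gap-pos to 0<δ; index to N)

  tail : ℕ → ℚ
  tail n = seq y (N ℕ.+ n)

  δ≤tail : ∀ n → δ ℚ.≤ tail n
  δ≤tail n = subst (ℚ._≤ tail n) (ℚ.+-identityˡ δ) (separate (N ℕ.+ n) (ℕ.m≤m+n N n))

  0<tail : ∀ n → 0ℚ ℚ.< tail n
  0<tail n = ℚ.<-≤-trans 0<δ (δ≤tail n)

  1/tail : ℕ → ℚ
  1/tail n = (ℚ.1/ tail n) {{ℚ.>-nonZero (0<tail n)}}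

  1/δ : ℚ
  1/δ = (ℚ.1/ δ) {{ℚ.>-nonZero 0<δ}}

  tail*1/tail : ∀ n → tail n ℚ.* 1/tail n ≡ 1ℚ
  tail*1/tail n = ℚ.*-inverseʳ (tail n) {{ℚ.>-nonZero (0<tail n)}}

  δ*1/δ : δ ℚ.* 1/δ ≡ 1ℚ
  δ*1/δ = ℚ.*-inverseʳ δ {{ℚ.>-nonZero 0<δ}}

  0<1/tail : ∀ n → 0ℚ ℚ.< 1/tail n
  0<1/tail n = 1/-0< (0<tail n)

  1/tail≤1/δ : ∀ n → 1/tail n ℚ.≤ 1/δ
  1/tail≤1/δ n = begin
    1/tail n                         ≡⟨ ℚ.*-identityˡ (1/tail n) ⟨
    1ℚ ℚ.* 1/tail n                  ≡⟨ cong (ℚ._* 1/tail n) δ*1/δ ⟨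
    δ ℚ.* 1/δ ℚ.* 1/tail n           ≡⟨ solve 3 (λ a b c → a :* b :* c := b :* (a :* c)) refl δ 1/δ (1/tail n) ⟩
    1/δ ℚ.* (δ ℚ.* 1/tail n)         ≤⟨ ℚ.*-monoˡ-≤-nonNeg 1/δ {{ℚ.nonNegative (ℚ.<⇒≤ (1/-0< 0<δ))}}
                                          (ℚ.*-monoʳ-≤-nonNeg (1/tail n) {{ℚ.nonNegative (ℚ.<⇒≤ (0<1/tail n))}} (δ≤tail n)) ⟩
    1/δ ℚ.* (tail n ℚ.* 1/tail n)    ≡⟨ cong (1/δ ℚ.*_) (tail*1/tail n) ⟩
    1/δ ℚ.* 1ℚ                       ≡⟨ ℚ.*-identityʳ 1/δ ⟩
    1/δ                              ∎
    where open ℚ.≤-Reasoning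
          open +-*-Solver

  difference : ∀ m n → 1/tail m ℚ.- 1/tail n ≡ 1/tail m ℚ.* 1/tail n ℚ.* (tail n ℚ.- tail m)
  difference m n = begin
    u ℚ.- v                                              ≡⟨ solve 2 (λ u v → u :- v := u :* con 1ℚ :- v :* con 1ℚ) refl u v ⟩
    u ℚ.* 1ℚ ℚ.- v ℚ.* 1ℚ                                ≡⟨ cong₂ (λ a b → u ℚ.* a ℚ.- v ℚ.* b) (tail*1/tail n) (tail*1/tail m) ⟨
    u ℚ.* (tail n ℚ.* v) ℚ.- v ℚ.* (tail m ℚ.* u)        ≡⟨ solve 4 (λ u v s t → u :* (t :* v) :- v :* (s :* u) := u :* v :* (t :- s)) refl u v (tail m) (tail n) ⟩
    u ℚ.* v ℚ.* (tail n ℚ.- tail m)                      ∎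
    where open ≡-Reasoning
          open +-*-Solver
          u = 1/tail m
          v = 1/tail n

  recip : ℝ
  recip .seq = 1/tail
  recip .cauchy ε 0<ε with cauchy y (ε ℚ.* (δ ℚ.* δ)) (*-0< 0<ε (*-0< 0<δ 0<δ))
  ... | M , close = M , λ m n M≤m M≤n →
    let u = 1/tail m ; v = 1/tail n ; s = tail m ; t = tail n in begin-strict
      ∣ u ℚ.- v ∣                          ≡⟨ cong ∣_∣ (difference m n) ⟩
      ∣ u ℚ.* v ℚ.* (t ℚ.- s) ∣            ≡⟨ ℚ.∣p*q∣≡∣p∣*∣q∣ (u ℚ.* v) (t ℚ.- s) ⟩
      ∣ u ℚ.* v ∣ ℚ.* ∣ t ℚ.- s ∣          ≡⟨ cong (ℚ._* ∣ t ℚ.- s ∣)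
                                                (ℚ.0≤p⇒∣p∣≡p (ℚ.<⇒≤ (*-0< (0<1/tail m) (0<1/tail n)))) ⟩
      u ℚ.* v ℚ.* ∣ t ℚ.- s ∣              ≤⟨ ℚ.*-monoʳ-≤-nonNeg ∣ t ℚ.- s ∣ {{ℚ.∣-∣-nonNeg (t ℚ.- s)}}
                                                (*-mono (ℚ.<⇒≤ (0<1/tail m)) (ℚ.<⇒≤ (1/-0< 0<δ)) (1/tail≤1/δ m) (1/tail≤1/δ n)) ⟩
      1/δ ℚ.* 1/δ ℚ.* ∣ t ℚ.- s ∣          <⟨ ℚ.*-monoʳ-<-pos (1/δ ℚ.* 1/δ) {{ℚ.positive (*-0< (1/-0< 0<δ) (1/-0< 0<δ))}}
                                                (close (N ℕ.+ n) (N ℕ.+ m) (ℕ.m≤n⇒m≤o+n N M≤n) (ℕ.m≤n⇒m≤o+n N M≤m)) ⟩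
      1/δ ℚ.* 1/δ ℚ.* (ε ℚ.* (δ ℚ.* δ))    ≡⟨ solve 3 (λ d e ε → e :* e :* (ε :* (d :* d)) := ε :* ((d :* e) :* (d :* e))) refl δ 1/δ ε ⟩
      ε ℚ.* (δ ℚ.* 1/δ ℚ.* (δ ℚ.* 1/δ))    ≡⟨ cong (λ p → ε ℚ.* (p ℚ.* p)) δ*1/δ ⟩
      ε ℚ.* (1ℚ ℚ.* 1ℚ)                    ≡⟨ solve 1 (λ ε → ε :* (con 1ℚ :* con 1ℚ) := ε) refl ε ⟩
      ε                                    ∎
    where open ℚ.≤-Reasoning
          open +-*-Solver

_÷_ : (x y : ℝ) → {{0ℝ < y}} → ℝ
_÷_ x y {{0<y}} = x * Reciprocal.recip y 0<y

0<n/1 : ∀ n → .{{NonZero n}} → 0ℚ ℚ.< + n ℚ./ 1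
0<n/1 n@(suc _) = ℚ.positive⁻¹ (+ n ℚ./ 1) {{ℚ.normalize-pos n 1}}

instance

  fromℕ-pos : ∀ {n} → .{{NonZero n}} → 0ℝ < fromℕ n
  fromℕ-pos {n} = mk< (+ n ℚ./ 1) (0<n/1 n) 0
    λ _ _ → ℚ.≤-reflexive (ℚ.+-identityˡ (+ n ℚ./ 1))

  *-pos : ∀ {x y} → {{0ℝ < x}} → {{0ℝ < y}} → 0ℝ < x * y
  *-pos {x} {y} {{mk< δ 0<δ M x≥δ}} {{mk< η 0<η N y≥η}} =
    mk< (δ ℚ.* η) (*-0< 0<δ 0<η) (M ℕ.⊔ N) λ n M⊔N≤n →
      let δ≤x = subst (ℚ._≤ seq x n) (ℚ.+-identityˡ δ) (x≥δ n (ℕ.≤-trans (ℕ.m≤m⊔n M N) M⊔N≤n))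
          η≤y = subst (ℚ._≤ seq y n) (ℚ.+-identityˡ η) (y≥η n (ℕ.≤-trans (ℕ.m≤n⊔m M N) M⊔N≤n))
      in subst (ℚ._≤ seq x n ℚ.* seq y n) (sym (ℚ.+-identityˡ (δ ℚ.* η)))
           (*-mono (ℚ.<⇒≤ 0<δ) (ℚ.<⇒≤ (ℚ.<-≤-trans 0<η η≤y)) δ≤x η≤y)

------------------------------------------------------------------------
-- Natural logarithm

1/suc : ℕ → ℚ
1/suc k = + 1 ℚ./ suc k

-- harmonic s l = 1/(s+1) + 1/(s+2) + ⋯ + 1/(s+l)
harmonic : ℕ → ℕ → ℚ
harmonic s zero    = 0ℚ
harmonic s (suc l) = harmonic s l ℚ.+ 1/suc (s ℕ.+ l)

toℚᵘ-1/suc : ∀ k → toℚᵘ (1/suc k) ℚᵘ.≃ ℚᵘ.mkℚᵘ (+ 1) k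
toℚᵘ-1/suc k = ℚ.toℚᵘ-fromℚᵘ (ℚᵘ.mkℚᵘ (+ 1) k)

1/suc-pos : ∀ k → 0ℚ ℚ.< 1/suc k
1/suc-pos k = ℚ.positive⁻¹ (1/suc k) {{ℚ.normalize-pos 1 (suc k)}}

1/suc-anti : ∀ {j k} → j ℕ.≤ k → 1/suc k ℚ.≤ 1/suc j
1/suc-anti {j} {k} j≤k = ℚ.toℚᵘ-cancel-≤
  (ℚᵘ.≤-respˡ-≃ (ℚᵘ.≃-sym (toℚᵘ-1/suc k)) (ℚᵘ.≤-respʳ-≃ (ℚᵘ.≃-sym (toℚᵘ-1/suc j))
    (ℚᵘ.*≤* (ℤ.*-monoˡ-≤-nonNeg (+ 1) (ℤ.+≤+ (ℕ.s≤s j≤k))))))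

archimedean : ∀ ε → 0ℚ ℚ.< ε → ∃ λ N → 1/suc N ℚ.< ε
archimedean ε@(ℚ.mkℚ (+ zero) d _) 0<ε with () ← ℚ.positive 0<ε
archimedean ε@(ℚ.mkℚ ℤ.-[1+ n ] d _) 0<ε with () ← ℚ.positive 0<ε
archimedean ε@(ℚ.mkℚ (+ suc n) d _) 0<ε = suc d , ℚ.toℚᵘ-cancel-<
  (ℚᵘ.<-respˡ-≃ (ℚᵘ.≃-sym (toℚᵘ-1/suc (suc d))) (ℚᵘ.*<* (ℤ.+<+ bound)))
  where
    bound : suc d ℕ.+ 0 ℕ.< suc n ℕ.* suc (suc d)
    bound = ℕ.≤-trans (ℕ.≤-reflexive (cong suc (ℕ.+-identityʳ (suc d))))
                      (ℕ.m≤m+n (suc (suc d)) (n ℕ.* suc (suc d)))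

suc/1 : ∀ n → + suc n ℚ./ 1 ≡ + n ℚ./ 1 ℚ.+ 1ℚ
suc/1 n = ℚ.toℚᵘ-injective (begin
  toℚᵘ (+ suc n ℚ./ 1)                 ≈⟨ ℚ.toℚᵘ-fromℚᵘ (ℚᵘ.mkℚᵘ (+ suc n) 0) ⟩
  ℚᵘ.mkℚᵘ (+ suc n) 0                  ≈⟨ ℚᵘ.*≡* (cong (ℤ._* + 1) numerators) ⟩
  ℚᵘ.mkℚᵘ (+ n) 0 ℚᵘ.+ toℚᵘ 1ℚ         ≈⟨ ℚᵘ.+-congˡ (toℚᵘ 1ℚ) (ℚ.toℚᵘ-fromℚᵘ (ℚᵘ.mkℚᵘ (+ n) 0)) ⟨
  toℚᵘ (+ n ℚ./ 1) ℚᵘ.+ toℚᵘ 1ℚ        ≈⟨ ℚ.toℚᵘ-homo-+ (+ n ℚ./ 1) 1ℚ ⟨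
  toℚᵘ (+ n ℚ./ 1 ℚ.+ 1ℚ)              ∎)
  where
    open ℚᵘ.≃-Reasoning
    numerators : + suc n ≡ + n ℤ.* + 1 ℤ.+ + 1
    numerators = trans (cong +_ (ℕ.+-comm 1 n)) (cong (ℤ._+ + 1) (sym (ℤ.*-identityʳ (+ n))))

scale : ∀ c j → + suc c ℚ./ 1 ℚ.* 1/suc (j ℕ.+ c ℕ.* suc j) ≡ 1/suc j
scale c j = ℚ.toℚᵘ-injective (begin
  toℚᵘ (+ suc c ℚ./ 1 ℚ.* 1/suc i)            ≈⟨ ℚ.toℚᵘ-homo-* (+ suc c ℚ./ 1) (1/suc i) ⟩
  toℚᵘ (+ suc c ℚ./ 1) ℚᵘ.* toℚᵘ (1/suc i)    ≈⟨ ℚᵘ.*-cong (ℚ.toℚᵘ-fromℚᵘ (ℚᵘ.mkℚᵘ (+ suc c) 0)) (toℚᵘ-1/suc i) ⟩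
  ℚᵘ.mkℚᵘ (+ suc c) 0 ℚᵘ.* ℚᵘ.mkℚᵘ (+ 1) i    ≈⟨ ℚᵘ.*≡* (cong +_ (lemma c j)) ⟩
  ℚᵘ.mkℚᵘ (+ 1) j                             ≈⟨ toℚᵘ-1/suc j ⟨
  toℚᵘ (1/suc j)                              ∎)
  where
    open ℚᵘ.≃-Reasoning
    i = j ℕ.+ c ℕ.* suc j
    lemma : ∀ c j → (suc c ℕ.* 1) ℕ.* suc j ≡ 1 ℕ.* (1 ℕ.* suc (j ℕ.+ c ℕ.* suc j))
    lemma = solve-∀

harmonic-upper : ∀ {s t} l → t ℕ.≤ s → harmonic s l ℚ.≤ + l ℚ./ 1 ℚ.* 1/suc t
harmonic-upper {s} {t} zero    t≤s = ℚ.≤-reflexive (sym (ℚ.*-zeroˡ (1/suc t)))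
harmonic-upper {s} {t} (suc l) t≤s = begin
  harmonic s l ℚ.+ 1/suc (s ℕ.+ l)           ≤⟨ ℚ.+-mono-≤ (harmonic-upper l t≤s) (1/suc-anti (ℕ.m≤n⇒m≤n+o l t≤s)) ⟩
  + l ℚ./ 1 ℚ.* 1/suc t ℚ.+ 1/suc t          ≡⟨ solve 2 (λ l u → l :* u :+ u := (l :+ con 1ℚ) :* u) refl (+ l ℚ./ 1) (1/suc t) ⟩
  (+ l ℚ./ 1 ℚ.+ 1ℚ) ℚ.* 1/suc t             ≡⟨ cong (ℚ._* 1/suc t) (suc/1 l) ⟨
  + suc l ℚ./ 1 ℚ.* 1/suc t                  ∎
  where open ℚ.≤-Reasoning
        open +-*-Solver

harmonic-lower : ∀ {s t} l → s ℕ.+ l ℕ.≤ suc t → + l ℚ./ 1 ℚ.* 1/suc t ℚ.≤ harmonic s l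
harmonic-lower {s} {t} zero    _ = ℚ.≤-reflexive (ℚ.*-zeroˡ (1/suc t))
harmonic-lower {s} {t} (suc l) s+1+l≤1+t = begin
  + suc l ℚ./ 1 ℚ.* 1/suc t                  ≡⟨ cong (ℚ._* 1/suc t) (suc/1 l) ⟩
  (+ l ℚ./ 1 ℚ.+ 1ℚ) ℚ.* 1/suc t             ≡⟨ solve 2 (λ l u → (l :+ con 1ℚ) :* u := l :* u :+ u) refl (+ l ℚ./ 1) (1/suc t) ⟩
  + l ℚ./ 1 ℚ.* 1/suc t ℚ.+ 1/suc t          ≤⟨ ℚ.+-mono-≤ (harmonic-lower l (ℕ.m≤n⇒m≤1+n s+l≤t)) (1/suc-anti s+l≤t) ⟩
  harmonic s l ℚ.+ 1/suc (s ℕ.+ l)           ∎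
  where open ℚ.≤-Reasoning
        open +-*-Solver
        s+l≤t : s ℕ.+ l ℕ.≤ t
        s+l≤t = ℕ.s≤s⁻¹ (subst (ℕ._≤ suc t) (ℕ.+-suc s l) s+1+l≤1+t)

harmonic-+ : ∀ s l k → harmonic s (l ℕ.+ k) ≡ harmonic s l ℚ.+ harmonic (s ℕ.+ l) k
harmonic-+ s l zero =
  trans (cong (harmonic s) (ℕ.+-identityʳ l)) (sym (ℚ.+-identityʳ (harmonic s l)))
harmonic-+ s l (suc k) = begin
  harmonic s (l ℕ.+ suc k)                                            ≡⟨ cong (harmonic s) (ℕ.+-suc l k) ⟩
  harmonic s (l ℕ.+ k) ℚ.+ 1/suc (s ℕ.+ (l ℕ.+ k))                    ≡⟨ cong₂ (λ p i → p ℚ.+ 1/suc i) (harmonic-+ s l k) (sym (ℕ.+-assoc s l k)) ⟩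
  harmonic s l ℚ.+ harmonic (s ℕ.+ l) k ℚ.+ 1/suc (s ℕ.+ l ℕ.+ k)     ≡⟨ ℚ.+-assoc (harmonic s l) _ _ ⟩
  harmonic s l ℚ.+ harmonic (s ℕ.+ l) (suc k)                         ∎
  where open ≡-Reasoning

harmonic-shift : ∀ k l → harmonic k l ℚ.≤ harmonic (suc k) l ℚ.+ 1/suc k
harmonic-shift k l = begin
  harmonic k l                                    ≡⟨ ℚ.+-identityʳ (harmonic k l) ⟨
  harmonic k l ℚ.+ 0ℚ                             ≤⟨ ℚ.+-monoʳ-≤ (harmonic k l) (ℚ.<⇒≤ (1/suc-pos (k ℕ.+ l))) ⟩
  harmonic k (1 ℕ.+ l)                            ≡⟨ harmonic-+ k 1 l ⟩
  0ℚ ℚ.+ 1/suc (k ℕ.+ 0) ℚ.+ harmonic (k ℕ.+ 1) l ≡⟨ cong₂ (λ i j → 0ℚ ℚ.+ 1/suc i ℚ.+ harmonic j l) (ℕ.+-identityʳ k) (ℕ.+-comm k 1) ⟩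
  0ℚ ℚ.+ 1/suc k ℚ.+ harmonic (suc k) l           ≡⟨ solve 2 (λ u h → con 0ℚ :+ u :+ h := h :+ u) refl (1/suc k) (harmonic (suc k) l) ⟩
  harmonic (suc k) l ℚ.+ 1/suc k                  ∎
  where open ℚ.≤-Reasoning
        open +-*-Solver

refine-lower : ∀ c k l → harmonic (suc k) l ℚ.≤ harmonic (suc c ℕ.* suc k) (l ℕ.* suc c)
refine-lower c k zero    = ℚ.≤-refl
refine-lower c k (suc l) = begin
  harmonic (suc k) l ℚ.+ 1/suc (suc k ℕ.+ l)             ≤⟨ ℚ.+-mono-≤ (refine-lower c k l) step ⟩
  harmonic S L ℚ.+ harmonic (S ℕ.+ L) (suc c)            ≡⟨ harmonic-+ S L (suc c) ⟨
  harmonic S (L ℕ.+ suc c)                               ≡⟨ cong (harmonic S) (ℕ.+-comm L (suc c)) ⟩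
  harmonic S (suc l ℕ.* suc c)                           ∎
  where
    open ℚ.≤-Reasoning
    S = suc c ℕ.* suc k
    L = l ℕ.* suc c
    lemma : ∀ c k l → suc c ℕ.* suc k ℕ.+ l ℕ.* suc c ℕ.+ suc c ≡ suc (suc k ℕ.+ l ℕ.+ c ℕ.* suc (suc k ℕ.+ l))
    lemma = solve-∀
    step : 1/suc (suc k ℕ.+ l) ℚ.≤ harmonic (S ℕ.+ L) (suc c)
    step = subst (ℚ._≤ harmonic (S ℕ.+ L) (suc c)) (scale c (suc k ℕ.+ l))
             (harmonic-lower (suc c) (ℕ.≤-reflexive (lemma c k l)))

refine-upper : ∀ c k l → harmonic (suc c ℕ.* suc k) (l ℕ.* suc c) ℚ.≤ harmonic k l
refine-upper c k zero    = ℚ.≤-refl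
refine-upper c k (suc l) = begin
  harmonic S (suc l ℕ.* suc c)                           ≡⟨ cong (harmonic S) (ℕ.+-comm L (suc c)) ⟨
  harmonic S (L ℕ.+ suc c)                               ≡⟨ harmonic-+ S L (suc c) ⟩
  harmonic S L ℚ.+ harmonic (S ℕ.+ L) (suc c)            ≤⟨ ℚ.+-mono-≤ (refine-upper c k l) step ⟩
  harmonic k l ℚ.+ 1/suc (k ℕ.+ l)                       ∎
  where
    open ℚ.≤-Reasoning
    S = suc c ℕ.* suc k
    L = l ℕ.* suc c
    lemma : ∀ c k l → suc (k ℕ.+ l ℕ.+ c ℕ.* suc (k ℕ.+ l)) ≡ suc c ℕ.* suc k ℕ.+ l ℕ.* suc c
    lemma = solve-∀
    step : harmonic (S ℕ.+ L) (suc c) ℚ.≤ 1/suc (k ℕ.+ l)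
    step = subst (harmonic (S ℕ.+ L) (suc c) ℚ.≤_) (scale c (k ℕ.+ l))
             (harmonic-upper (suc c) (ℕ.≤-trans (ℕ.n≤1+n _) (ℕ.≤-reflexive (lemma c k l))))

-- The right-endpoint Riemann sum of ∫₁ⁿ dt/t with mesh 1/m, m = suc k:
--   ∑ (1/m) · 1/(1 + i/m)  =  ∑ 1/(m + i)    over 1 ≤ i ≤ (n - 1) m.
logSum : ℕ → ℕ → ℚ
logSum n k = harmonic (suc k) (pred n ℕ.* suc k)

logSum-close : ∀ n j k → logSum n j ℚ.≤ logSum n k ℚ.+ 1/suc k
logSum-close n j k = begin
  harmonic (suc j) (L ℕ.* suc j)                            ≤⟨ refine-lower k j (L ℕ.* suc j) ⟩
  harmonic (suc k ℕ.* suc j) (L ℕ.* suc j ℕ.* suc k)        ≡⟨ cong₂ harmonic (ℕ.*-comm (suc k) (suc j)) (lemma L (suc j) (suc k)) ⟩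
  harmonic (suc j ℕ.* suc k) (L ℕ.* suc k ℕ.* suc j)        ≤⟨ refine-upper j k (L ℕ.* suc k) ⟩
  harmonic k (L ℕ.* suc k)                                  ≤⟨ harmonic-shift k (L ℕ.* suc k) ⟩
  harmonic (suc k) (L ℕ.* suc k) ℚ.+ 1/suc k                ∎
  where
    open ℚ.≤-Reasoning
    L = pred n
    lemma : ∀ a b c → a ℕ.* b ℕ.* c ≡ a ℕ.* c ℕ.* b
    lemma = solve-∀

log : (n : ℕ) → .{{NonZero n}} → ℝ
log n .seq = logSum n
log n .cauchy ε 0<ε with N , 1/N<ε ← archimedean ε 0<ε = N , λ j k N≤j N≤k →
  ℚ.≤-<-trans
    (∣∣-bound
      (ℚ.≤-trans (logSum-close n j k) (ℚ.+-monoʳ-≤ (logSum n k) (1/suc-anti N≤k)))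
      (ℚ.≤-trans (logSum-close n k j) (ℚ.+-monoʳ-≤ (logSum n j) (1/suc-anti N≤j))))
    1/N<ε

instance

  log-pos : ∀ {n} → .{{_ : NonTrivial n}} → 0ℝ < log n {{ℕ.nonTrivial⇒nonZero n}}
  log-pos {n@(suc (suc r))} = mk< ℚ.½ 0<½ 0 λ k _ → begin
    0ℚ ℚ.+ ℚ.½                                    ≡⟨ ℚ.+-identityˡ ℚ.½ ⟩
    1/suc 1                                       ≡⟨ scale k 1 ⟨
    + suc k ℚ./ 1 ℚ.* 1/suc (1 ℕ.+ k ℕ.* 2)       ≤⟨ harmonic-lower (suc k) (ℕ.≤-reflexive (lemma k)) ⟩
    harmonic (suc k) (suc k)                      ≡⟨ ℚ.+-identityʳ _ ⟨
    harmonic (suc k) (suc k) ℚ.+ 0ℚ               ≤⟨ ℚ.+-monoʳ-≤ (harmonic (suc k) (suc k))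
                                                       (harmonic-≥0 (suc k ℕ.+ suc k) (r ℕ.* suc k)) ⟩
    harmonic (suc k) (suc k) ℚ.+ harmonic (suc k ℕ.+ suc k) (r ℕ.* suc k)
                                                  ≡⟨ harmonic-+ (suc k) (suc k) (r ℕ.* suc k) ⟨
    logSum n k                                    ∎
    where
      open ℚ.≤-Reasoning
      lemma : ∀ k → suc k ℕ.+ suc k ≡ suc (1 ℕ.+ k ℕ.* 2)
      lemma = solve-∀
      harmonic-≥0 : ∀ s l → 0ℚ ℚ.≤ harmonic s l
      harmonic-≥0 s zero    = ℚ.≤-refl
      harmonic-≥0 s (suc l) = ℚ.+-mono-≤ (harmonic-≥0 s l) (ℚ.<⇒≤ (1/suc-pos (s ℕ.+ l)))

------------------------------------------------------------------------
-- Extended reals as open lower cuts of rationals: the empty cut is -∞ and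
-- the full cut is +∞.

record ℝ̄ : Set₁ where
  no-eta-equality
  field
    Below     : ℚ → Set
    downwards : ∀ {p q} → p ℚ.< q → Below q → Below p
    rounded   : ∀ {p} → Below p → ∃ λ q → p ℚ.< q × Below q

open ℝ̄ public

infix 4 _≤_
_≤_ : ℝ̄ → ℝ̄ → Set
X ≤ Y = ∀ {q} → Below X q → Below Y q

fromℝ : ℝ → ℝ̄
fromℝ x .Below q = fromℚ q < x
fromℝ x .downwards p<q (mk< δ 0<δ N sep) = mk< δ 0<δ N λ n N≤n →
  ℚ.≤-trans (ℚ.+-monoˡ-≤ δ (ℚ.<⇒≤ p<q)) (sep n N≤n)
fromℝ x .rounded {p} (mk< δ 0<δ N sep) =
  p ℚ.+ δ ℚ.* ℚ.½ ,
  subst (ℚ._< p ℚ.+ δ ℚ.* ℚ.½) (ℚ.+-identityʳ p) (ℚ.+-monoʳ-< p (*-0< 0<δ 0<½)) ,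
  mk< (δ ℚ.* ℚ.½) (*-0< 0<δ 0<½) N λ n N≤n → subst (ℚ._≤ seq x n)
    (solve 2 (λ p δ → p :+ δ := p :+ δ :* con ℚ.½ :+ δ :* con ℚ.½) refl p δ) (sep n N≤n)
  where open +-*-Solver

⨆ : {I : Set} → (I → ℝ̄) → ℝ̄
⨆ X .Below q = ∃ λ i → Below (X i) q
⨆ X .downwards p<q (i , q<Xi) = i , downwards (X i) p<q q<Xi
⨆ X .rounded (i , p<Xi) with rounded (X i) p<Xi
... | q , p<q , q<Xi = q , p<q , i , q<Xi

-- An intersection of open cuts need not be open, hence the margin p < q.
⨅ : {I : Set} → (I → ℝ̄) → ℝ̄
⨅ X .Below p = ∃ λ q → p ℚ.< q × (∀ i → Below (X i) q)
⨅ X .downwards p<q (r , q<r , r<X) = r , ℚ.<-trans p<q q<r , r<X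
⨅ X .rounded (r , p<r , r<X) with ℚ.<-dense p<r
... | q , p<q , q<r = q , p<q , r , q<r , r<X

limsup : (ℕ → ℝ) → ℝ̄
limsup x = ⨅ λ N → ⨆ λ k → fromℝ (x (N ℕ.+ k))

{-# OPTIONS --safe #-}
module Submission where

-- Give each pair of elements of A at distance d > 0 the weight max(L - d, 0).
-- At most g pairs have a given distance, so any finite set of pairs weighs at
-- most g L² / 2 (Ruler.∑-rowWeight-upper).
--
-- For a lower bound the pairs are grouped by the difference κ of their indices.
-- The distances in such a row telescope: its first I pairs have distances
-- summing to at most κ a_(I+κ), so the row weighs at least I L - κ a_(I+κ)
-- (Ruler.rowWeight-lower). Suppose that a_n ≤ C s n² whenever n ≤ 2^s. With
-- n = I + κ close to the maximiser L / (2 C κ s) the row weighs at least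
-- L² / (4 C κ s), up to O(κ L) (optimal-row, optimal-row-rounded).
--
-- Let L = Q J 4^T. For κ in the dyadic block Q 2^t < κ ≤ Q 2^(t+1), t < T, the
-- choice s = 2 T - t satisfies n ≤ 2^s, provided that T is large compared with
-- J. The reciprocals of the κ in one block sum to about log 2. The reciprocals
-- of s = T + 1, …, 2 T again sum to about log 2. Hence L² (log 2)² / (4 C) ≤ g L² / 2 up to lower order terms
-- (SingleScale.scale-inequality), that is (log 2)² ≤ 2 g C in the limit.
--
-- The logarithm enters only through log n ≤ ⌈log₂ n⌉ log 2 (logSum-upper). If
-- r < log 2 / (2 g) and C = r ℓ with ℓ a rational slightly above log 2, then
-- 2 g C < (log 2)², so a_n ≤ C ⌈log₂ n⌉ n² must fail for some n in an explicit
-- finite range that starts arbitrarily far out, and the failure gives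
-- a_n > r n² log n. These inequalities between rationals are decidable, so n is
-- found by bounded search (Frequently.frequently).
--
-- Throughout, harmonic n n = 1/(n+1) + ⋯ + 1/(2n) serves as the rational
-- approximation of log 2: it grows along multiples of n, and it is within 1/n
-- of an upper bound for all its values.

open import Defs hiding (_<_; _≤_; _*_)
open import Data.Empty using (⊥; ⊥-elim)
import Data.Integer.Base as ℤ
import Data.Integer.Properties as ℤ
open import Data.List.Base using (List; []; _∷_; _++_; map; filter; length; upTo; cartesianProduct)
open import Data.List.Properties using (filter-none; filter-accept; filter-reject; length-map; map-++; map-∘; map-cong; upTo-∷ʳ)
open import Data.List.Relation.Unary.All as All using (All; []; _∷_)
import Data.List.Relation.Unary.All.Properties as All
open import Data.List.Relation.Unary.Unique.Propositional using (Unique)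
import Data.List.Relation.Unary.Unique.Propositional.Properties as Unique
import Data.Nat.Base as ℕ
open import Data.Nat.Base using (ℕ; zero; suc; pred; NonZero)
open import Data.Nat.Induction using (<-rec)
open import Data.Nat.ListAction using (sum)
open import Data.Nat.ListAction.Properties using (sum-++)
open import Data.Nat.Logarithm using (⌈log₂_⌉; ⌈log₂⌉-mono-≤; ⌈log₂⌈n/2⌉⌉≡⌈log₂n⌉∸1; ⌈log₂2^n⌉≡n)
import Data.Nat.Properties as ℕ
open import Data.Nat.Tactic.RingSolver using (solve-∀)
open import Data.Product using (∃; _×_; _,_)
open import Data.Product.Properties using (,-injective)
import Data.Rational.Unnormalised.Base as ℚᵘ
import Data.Rational.Unnormalised.Properties as ℚᵘ
open import Data.Sum.Base using (_⊎_; inj₁; inj₂; [_,_]′)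
open import Function.Base using (_∘_; id)
open import Level using (0ℓ)
open import Relation.Binary.Definitions using (tri<; tri≈; tri>)
open import Relation.Binary.PropositionalEquality
open import Relation.Nullary using (Dec; yes; no; contradiction; _×-dec_)
open import Relation.Unary using (Pred)

-- Combinatorics of natural numbers

module Combinatorics where

  open import Data.Nat.Base
  open import Data.Nat.Properties

  -- Finite sums

  -- ∑ n f = f 0 + ⋯ + f (n - 1)
  ∑ : ℕ → (ℕ → ℕ) → ℕ
  ∑ zero    f = 0
  ∑ (suc n) f = ∑ n f + f n

  ∑-mono : ∀ n {f h} → (∀ i → f i ≤ h i) → ∑ n f ≤ ∑ n h
  ∑-mono zero    f≤h = z≤n
  ∑-mono (suc n) f≤h = +-mono-≤ (∑-mono n f≤h) (f≤h n)

  ∑-monoˡ : ∀ {m n} f → m ≤ n → ∑ m f ≤ ∑ n f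
  ∑-monoˡ {n = zero}  f z≤n = z≤n
  ∑-monoˡ {m} {suc n} f m≤1+n with m≤n⇒m<n∨m≡n m≤1+n
  ... | inj₁ m<1+n = ≤-trans (∑-monoˡ f (s≤s⁻¹ m<1+n)) (m≤m+n _ (f n))
  ... | inj₂ refl  = ≤-refl

  ∑-distrib-+ : ∀ n f h → ∑ n (λ i → f i + h i) ≡ ∑ n f + ∑ n h
  ∑-distrib-+ zero    f h = refl
  ∑-distrib-+ (suc n) f h = trans (cong (_+ (f n + h n)) (∑-distrib-+ n f h))
    (lemma (∑ n f) (∑ n h) (f n) (h n))
    where
    lemma : ∀ a b c d → a + b + (c + d) ≡ a + c + (b + d)
    lemma = solve-∀

  ∑-const : ∀ n c → ∑ n (λ _ → c) ≡ n * c
  ∑-const zero    c = refl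
  ∑-const (suc n) c = trans (cong (_+ c) (∑-const n c)) (+-comm (n * c) c)

  ∑-split : ∀ m n f → ∑ (m + n) f ≡ ∑ m f + ∑ n (λ i → f (m + i))
  ∑-split m zero    f = trans (cong (λ l → ∑ l f) (+-identityʳ m)) (sym (+-identityʳ _))
  ∑-split m (suc n) f = begin
    ∑ (m + suc n) f                                ≡⟨ cong (λ l → ∑ l f) (+-suc m n) ⟩
    ∑ (m + n) f + f (m + n)                        ≡⟨ cong (_+ f (m + n)) (∑-split m n f) ⟩
    ∑ m f + ∑ n (λ i → f (m + i)) + f (m + n)      ≡⟨ +-assoc (∑ m f) _ _ ⟩
    ∑ m f + (∑ n (λ i → f (m + i)) + f (m + n))    ∎
    where open ≡-Reasoning

  sum-upTo : ∀ f n → sum (map f (upTo n)) ≡ ∑ n f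
  sum-upTo f zero    = refl
  sum-upTo f (suc n) = begin
    sum (map f (upTo (suc n)))             ≡⟨ cong (sum ∘ map f) (upTo-∷ʳ n) ⟨
    sum (map f (upTo n ++ n ∷ []))         ≡⟨ cong sum (map-++ f (upTo n) (n ∷ [])) ⟩
    sum (map f (upTo n) ++ f n ∷ [])       ≡⟨ sum-++ (map f (upTo n)) (f n ∷ []) ⟩
    sum (map f (upTo n)) + (f n + 0)       ≡⟨ cong₂ _+_ (sum-upTo f n) (+-identityʳ (f n)) ⟩
    ∑ n f + f n                            ∎
    where open ≡-Reasoning

  sum-cartesianProduct : ∀ {X Y : Set} (f : X × Y → ℕ) xs ys →
    sum (map f (cartesianProduct xs ys)) ≡ sum (map (λ x → sum (map (λ y → f (x , y)) ys)) xs)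
  sum-cartesianProduct f []       ys = refl
  sum-cartesianProduct f (x ∷ xs) ys = begin
    sum (map f (map (x ,_) ys ++ cartesianProduct xs ys))
      ≡⟨ cong sum (map-++ f (map (x ,_) ys) _) ⟩
    sum (map f (map (x ,_) ys) ++ map f (cartesianProduct xs ys))
      ≡⟨ sum-++ (map f (map (x ,_) ys)) _ ⟩
    sum (map f (map (x ,_) ys)) + sum (map f (cartesianProduct xs ys))
      ≡⟨ cong₂ _+_ (cong sum (sym (map-∘ ys))) (sum-cartesianProduct f xs ys) ⟩
    sum (map (λ y → f (x , y)) ys) + sum (map (λ x → sum (map (λ y → f (x , y)) ys)) xs) ∎
    where open ≡-Reasoning

  ∑∑-as-list : ∀ (f : ℕ × ℕ → ℕ) M I →
    sum (map f (cartesianProduct (upTo M) (upTo I))) ≡ ∑ M (λ k → ∑ I (λ i → f (k , i)))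
  ∑∑-as-list f M I = begin
    sum (map f (cartesianProduct (upTo M) (upTo I)))
      ≡⟨ sum-cartesianProduct f (upTo M) (upTo I) ⟩
    sum (map (λ k → sum (map (λ i → f (k , i)) (upTo I))) (upTo M))
      ≡⟨ cong sum (map-cong (λ k → sum-upTo (λ i → f (k , i)) I) (upTo M)) ⟩
    sum (map (λ k → ∑ I (λ i → f (k , i))) (upTo M))
      ≡⟨ sum-upTo _ M ⟩
    ∑ M (λ k → ∑ I (λ i → f (k , i))) ∎
    where open ≡-Reasoning

  -- Counting items by size

  -- Items x with a size δ x, where at most g items have any given positive size.
  module Counting {X : Set} (δ : X → ℕ) where

    -- The number of items of size exactly d, and of size at most d.
    #≡ #≤ : ℕ → List X → ℕ
    #≡ d xs = length (filter (λ x → δ x ≟ d) xs)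
    #≤ d xs = length (filter (λ x → δ x ≤? d) xs)

    -- The total of max(L - δ x, 0).
    weight : ℕ → List X → ℕ
    weight L xs = sum (map (λ x → L ∸ δ x) xs)

    #≡-yes : ∀ {d x} xs → δ x ≡ d → #≡ d (x ∷ xs) ≡ suc (#≡ d xs)
    #≡-yes xs p = cong length (filter-accept _ {xs = xs} p)

    #≡-no : ∀ {d x} xs → δ x ≢ d → #≡ d (x ∷ xs) ≡ #≡ d xs
    #≡-no xs p = cong length (filter-reject _ {xs = xs} p)

    #≤-yes : ∀ {d x} xs → δ x ≤ d → #≤ d (x ∷ xs) ≡ suc (#≤ d xs)
    #≤-yes xs p = cong length (filter-accept _ {xs = xs} p)

    #≤-no : ∀ {d x} xs → δ x ≰ d → #≤ d (x ∷ xs) ≡ #≤ d xs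
    #≤-no xs p = cong length (filter-reject _ {xs = xs} p)

    #≤-suc : ∀ d xs → #≤ (suc d) xs ≡ #≡ (suc d) xs + #≤ d xs
    #≤-suc d []       = refl
    #≤-suc d (x ∷ xs) with <-cmp (δ x) (suc d)
    ... | tri< δ<1+d δ≢1+d _ = begin
      #≤ (suc d) (x ∷ xs)                ≡⟨ #≤-yes xs (<⇒≤ δ<1+d) ⟩
      suc (#≤ (suc d) xs)                ≡⟨ cong suc (#≤-suc d xs) ⟩
      suc (#≡ (suc d) xs + #≤ d xs)      ≡⟨ +-suc _ _ ⟨
      #≡ (suc d) xs + suc (#≤ d xs)      ≡⟨ cong₂ _+_ (#≡-no xs δ≢1+d) (#≤-yes xs (s≤s⁻¹ δ<1+d)) ⟨
      #≡ (suc d) (x ∷ xs) + #≤ d (x ∷ xs) ∎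
      where open ≡-Reasoning
    ... | tri≈ _ δ≡1+d _ = begin
      #≤ (suc d) (x ∷ xs)                ≡⟨ #≤-yes xs (≤-reflexive δ≡1+d) ⟩
      suc (#≤ (suc d) xs)                ≡⟨ cong suc (#≤-suc d xs) ⟩
      suc (#≡ (suc d) xs) + #≤ d xs      ≡⟨ cong₂ _+_ (#≡-yes xs δ≡1+d) (#≤-no xs (<⇒≱ (≤-reflexive (sym δ≡1+d)))) ⟨
      #≡ (suc d) (x ∷ xs) + #≤ d (x ∷ xs) ∎
      where open ≡-Reasoning
    ... | tri> _ δ≢1+d 1+d<δ = begin
      #≤ (suc d) (x ∷ xs)                ≡⟨ #≤-no xs (<⇒≱ 1+d<δ) ⟩
      #≤ (suc d) xs                      ≡⟨ #≤-suc d xs ⟩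
      #≡ (suc d) xs + #≤ d xs            ≡⟨ cong₂ _+_ (#≡-no xs δ≢1+d) (#≤-no xs (<⇒≱ (<-trans (n<1+n d) 1+d<δ))) ⟨
      #≡ (suc d) (x ∷ xs) + #≤ d (x ∷ xs) ∎
      where open ≡-Reasoning

    -- Increasing L by one adds one for each item of size at most L.
    weight-suc : ∀ L xs → weight (suc L) xs ≡ weight L xs + #≤ L xs
    weight-suc L []       = refl
    weight-suc L (x ∷ xs) with ≤-<-connex (δ x) L
    ... | inj₁ δ≤L = begin
      suc L ∸ δ x + weight (suc L) xs              ≡⟨ cong₂ _+_ (+-∸-assoc 1 δ≤L) (weight-suc L xs) ⟩
      suc (L ∸ δ x) + (weight L xs + #≤ L xs)      ≡⟨ lemma (L ∸ δ x) (weight L xs) (#≤ L xs) ⟩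
      L ∸ δ x + weight L xs + suc (#≤ L xs)        ≡⟨ cong (L ∸ δ x + weight L xs +_) (#≤-yes xs δ≤L) ⟨
      L ∸ δ x + weight L xs + #≤ L (x ∷ xs)        ∎
      where
      open ≡-Reasoning
      lemma : ∀ a b c → suc a + (b + c) ≡ a + b + suc c
      lemma = solve-∀
    ... | inj₂ L<δ = begin
      suc L ∸ δ x + weight (suc L) xs              ≡⟨ cong₂ _+_ (m≤n⇒m∸n≡0 L<δ) (weight-suc L xs) ⟩
      weight L xs + #≤ L xs                        ≡⟨ cong₂ (λ m n → m + weight L xs + n) (m≤n⇒m∸n≡0 (<⇒≤ L<δ)) (#≤-no xs (<⇒≱ L<δ)) ⟨
      L ∸ δ x + weight L xs + #≤ L (x ∷ xs)        ∎
      where open ≡-Reasoning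

    module _ {g : ℕ} {xs : List X} (0<δ : All (λ x → 0 < δ x) xs)
             (#≡≤g : ∀ d → 0 < d → #≡ d xs ≤ g) where

      #≤-bound : ∀ d → #≤ d xs ≤ d * g
      #≤-bound zero    = ≤-reflexive (cong length
        (filter-none (λ x → δ x ≤? 0) (All.map <⇒≱ 0<δ)))
      #≤-bound (suc d) = begin
        #≤ (suc d) xs                 ≡⟨ #≤-suc d xs ⟩
        #≡ (suc d) xs + #≤ d xs       ≤⟨ +-mono-≤ (#≡≤g (suc d) z<s) (#≤-bound d) ⟩
        g + d * g                     ∎
        where open ≤-Reasoning

      weight-bound : ∀ L → 2 * weight L xs ≤ g * (L * L)
      weight-bound zero    = ≤-trans (≤-reflexive (cong (2 *_) (weight-0 xs))) z≤n
        where
        weight-0 : ∀ xs → weight 0 xs ≡ 0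
        weight-0 []       = refl
        weight-0 (x ∷ xs) = cong₂ _+_ (0∸n≡0 (δ x)) (weight-0 xs)
      weight-bound (suc L) = begin
        2 * weight (suc L) xs             ≡⟨ cong (2 *_) (weight-suc L xs) ⟩
        2 * (weight L xs + #≤ L xs)       ≡⟨ *-distribˡ-+ 2 (weight L xs) _ ⟩
        2 * weight L xs + 2 * #≤ L xs     ≤⟨ +-mono-≤ (weight-bound L) (*-monoʳ-≤ 2 (#≤-bound L)) ⟩
        g * (L * L) + 2 * (L * g)         ≤⟨ m≤m+n _ g ⟩
        g * (L * L) + 2 * (L * g) + g     ≡⟨ lemma g L ⟩
        g * (suc L * suc L)               ∎
        where
        open ≤-Reasoning
        lemma : ∀ g L → g * (L * L) + 2 * (L * g) + g ≡ g * (suc L * suc L)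
        lemma = solve-∀

  telescope : ∀ {f : ℕ → ℕ} → (∀ {i j} → i ≤ j → f i ≤ f j) → ∀ I →
    ∑ I (λ i → f (suc i) ∸ f i) ≤ f I
  telescope         mono zero    = z≤n
  telescope {f = f} mono (suc I) = begin
    ∑ I (λ i → f (suc i) ∸ f i) + (f (suc I) ∸ f I)   ≤⟨ +-monoˡ-≤ _ (telescope mono I) ⟩
    f I + (f (suc I) ∸ f I)                           ≡⟨ m+[n∸m]≡n (mono (n≤1+n I)) ⟩
    f (suc I)                                         ∎
    where open ≤-Reasoning

  -- Induction on κ: the differences of lag κ + 1 split into those of lag κ and
  -- consecutive differences, which telescope.
  ∑-differences : ∀ {f : ℕ → ℕ} → (∀ {i j} → i ≤ j → f i ≤ f j) → ∀ κ I {B} →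
    (∀ {j} → j < I + κ → f j ≤ B) →
    ∑ I (λ i → f (i + κ) ∸ f i) ≤ κ * B
  ∑-differences {f} mono zero I {B} f≤B = begin
    ∑ I (λ i → f (i + 0) ∸ f i)     ≤⟨ ∑-mono I (λ i → ≤-reflexive (m≤n⇒m∸n≡0 (≤-reflexive (cong f (+-identityʳ i))))) ⟩
    ∑ I (λ _ → 0)                   ≡⟨ ∑-const I 0 ⟩
    I * 0                           ≡⟨ *-zeroʳ I ⟩
    0                               ∎
    where open ≤-Reasoning
  ∑-differences {f} mono (suc κ) I {B} f≤B = begin
    ∑ I (λ i → f (i + suc κ) ∸ f i)
      ≤⟨ ∑-mono I (λ i → subst (λ j → f j ∸ f i ≤ f (suc i + κ) ∸ f (i + κ) + (f (i + κ) ∸ f i)) (sym (+-suc i κ))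
           (m≤n+o⇒m∸n≤o _ (f i) (triangle i))) ⟩
    ∑ I (λ i → f (suc i + κ) ∸ f (i + κ) + (f (i + κ) ∸ f i))
      ≡⟨ ∑-distrib-+ I _ _ ⟩
    ∑ I (λ i → f (suc i + κ) ∸ f (i + κ)) + ∑ I (λ i → f (i + κ) ∸ f i)
      ≤⟨ +-mono-≤ (telescope {f = λ i → f (i + κ)} (λ i≤j → mono (+-monoˡ-≤ κ i≤j)) I)
           (∑-differences mono κ I (λ j<I+κ → f≤B (<-≤-trans j<I+κ (+-monoʳ-≤ I (n≤1+n κ))))) ⟩
    f (I + κ) + κ * B
      ≤⟨ +-monoˡ-≤ (κ * B) (f≤B (+-monoʳ-< I (n<1+n κ))) ⟩
    B + κ * B ∎
    where
    open ≤-Reasoning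
    triangle : ∀ i → f (suc i + κ) ≤ f i + (f (suc i + κ) ∸ f (i + κ) + (f (i + κ) ∸ f i))
    triangle i = begin
      f (suc i + κ)                                                 ≡⟨ m+[n∸m]≡n (mono (n≤1+n (i + κ))) ⟨
      f (i + κ) + (f (suc i + κ) ∸ f (i + κ))                       ≡⟨ cong (_+ (f (suc i + κ) ∸ f (i + κ))) (m+[n∸m]≡n (mono (m≤m+n i κ))) ⟨
      f i + (f (i + κ) ∸ f i) + (f (suc i + κ) ∸ f (i + κ))         ≡⟨ swap (f i) (f (i + κ) ∸ f i) (f (suc i + κ) ∸ f (i + κ)) ⟩
      f i + (f (suc i + κ) ∸ f (i + κ) + (f (i + κ) ∸ f i))         ∎
      where
      swap : ∀ x y z → x + y + z ≡ x + (z + y)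
      swap = solve-∀

  -- Pairs of elements of a Golomb ruler

  module Ruler {g A a} (golomb : IsGolombRuler g A) (enum : IsIncreasingEnumeration A a) where

    open IsIncreasingEnumeration enum

    monotone : ∀ {i j} → i ≤ j → a i ≤ a j
    monotone i≤j with m≤n⇒m<n∨m≡n i≤j
    ... | inj₁ i<j  = <⇒≤ (increasing i<j)
    ... | inj₂ refl = ≤-refl

    a-injective : ∀ {i j} → a i ≡ a j → i ≡ j
    a-injective {i} {j} eq with <-cmp i j
    ... | tri< i<j _ _ = contradiction eq (<⇒≢ (increasing i<j))
    ... | tri≈ _ i≡j _ = i≡j
    ... | tri> _ _ j<i = contradiction (sym eq) (<⇒≢ (increasing j<i))

    -- The pair with lower index i and index difference k + 1, and its distance.
    pair : ℕ × ℕ → ℕ × ℕ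
    pair (k , i) = a (i + suc k) , a i

    δ : ℕ × ℕ → ℕ
    δ (k , i) = a (i + suc k) ∸ a i

    pair-injective : ∀ {p q} → pair p ≡ pair q → p ≡ q
    pair-injective {k , i} {l , j} eq with ,-injective eq
    ... | eq₁ , eq₂ with a-injective eq₂
    ... | refl = cong (_, i) (suc-injective (+-cancelˡ-≡ i _ _ (a-injective eq₁)))

    -- The weight of the first I pairs with index difference k + 1.
    rowWeight : ℕ → ℕ → ℕ → ℕ
    rowWeight L I k = ∑ I (λ i → L ∸ (a (i + suc k) ∸ a i))

    open Counting δ

    i<i+1+k : ∀ i k → i < i + suc k
    i<i+1+k i k = m<m+n i z<s

    ∑-rowWeight-upper : ∀ L M I → 2 * ∑ M (rowWeight L I) ≤ g * (L * L)
    ∑-rowWeight-upper L M I = subst (λ s → 2 * s ≤ g * (L * L))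
      (∑∑-as-list (λ p → L ∸ δ p) M I)
      (weight-bound {xs = xs} (All.universal (λ (k , i) → m<n⇒0<n∸m (increasing (i<i+1+k i k))) xs) few L)
      where
      xs = cartesianProduct (upTo M) (upTo I)

      few : ∀ d → 0 < d → #≡ d xs ≤ g
      few d 0<d = subst (_≤ g) (length-map pair ys)
        (golomb d 0<d (map pair ys) unique
          (All.map⁺ (All.map (λ { {k , i} δ≡d → sound _ , sound _ , split k i δ≡d }) (All.all-filter _ xs))))
        where
        ys = filter (λ p → δ p ≟ d) xs
        unique : Unique (map pair ys)
        unique = Unique.map⁺ pair-injective (Unique.filter⁺ _ (Unique.cartesianProduct⁺ (Unique.upTo⁺ M) (Unique.upTo⁺ I)))
        split : ∀ k i → δ (k , i) ≡ d → a (i + suc k) ≡ d + a i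
        split k i refl = sym (m∸n+n≡m (<⇒≤ (increasing (i<i+1+k i k))))

    -- Each term satisfies L ≤ (L ∸ d) + d. The row may be longer than I since
    -- its further terms are nonnegative. The index I + k is 0-based: it is that
    -- of the n-th element for n = I + (k + 1).
    rowWeight-lower : ∀ L k {I I′} → I ≤ I′ → I * L ≤ rowWeight L I′ k + suc k * a (I + k)
    rowWeight-lower L k {I} {I′} I≤I′ = begin
      I * L                                             ≡⟨ ∑-const I L ⟨
      ∑ I (λ _ → L)                                     ≤⟨ ∑-mono I (λ i → m≤n+m∸n′ L (d i)) ⟩
      ∑ I (λ i → L ∸ d i + d i)                         ≡⟨ ∑-distrib-+ I _ _ ⟩
      rowWeight L I k + ∑ I d                           ≤⟨ +-mono-≤ (∑-monoˡ _ I≤I′) (∑-differences monotone (suc k) I last) ⟩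
      rowWeight L I′ k + suc k * a (I + k)              ∎
      where
      open ≤-Reasoning
      d : ℕ → ℕ
      d i = a (i + suc k) ∸ a i
      m≤n+m∸n′ : ∀ m n → m ≤ m ∸ n + n
      m≤n+m∸n′ m n = ≤-trans (m≤n+m∸n m n) (≤-reflexive (+-comm n (m ∸ n)))
      last : ∀ {j} → j < I + suc k → a j ≤ a (I + k)
      last {j} j<I+1+k = monotone (s≤s⁻¹ (subst (suc j ≤_) (+-suc I k) j<I+1+k))

  -- Binary logarithm

  n≤2^⌈log₂n⌉ : ∀ n → n ≤ 2 ^ ⌈log₂ n ⌉
  n≤2^⌈log₂n⌉ = <-rec _ step
    where
    step : ∀ n → (∀ {m} → m < n → m ≤ 2 ^ ⌈log₂ m ⌉) → n ≤ 2 ^ ⌈log₂ n ⌉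
    step 0 rec = z≤n
    step 1 rec = m^n>0 2 ⌈log₂ 1 ⌉
    step n@(suc (suc m)) rec = begin
      n                              ≡⟨ ⌊n/2⌋+⌈n/2⌉≡n n ⟨
      ⌊ n /2⌋ + ⌈ n /2⌉              ≤⟨ +-monoˡ-≤ ⌈ n /2⌉ (⌊n/2⌋≤⌈n/2⌉ n) ⟩
      ⌈ n /2⌉ + ⌈ n /2⌉              ≤⟨ +-mono-≤ half≤ half≤ ⟩
      2 ^ l + 2 ^ l                  ≡⟨ cong (2 ^ l +_) (+-identityʳ (2 ^ l)) ⟨
      2 ^ suc l                      ≡⟨ cong (2 ^_) (trans (cong suc (⌈log₂⌈n/2⌉⌉≡⌈log₂n⌉∸1 n)) (m+[n∸m]≡n 1≤log)) ⟩
      2 ^ ⌈log₂ n ⌉                  ∎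
      where
      open ≤-Reasoning
      l = ⌈log₂ ⌈ n /2⌉ ⌉
      half≤ : ⌈ n /2⌉ ≤ 2 ^ l
      half≤ = rec (⌈n/2⌉<n m)
      1≤log : 1 ≤ ⌈log₂ n ⌉
      1≤log = subst (_≤ ⌈log₂ n ⌉) (⌈log₂2^n⌉≡n 1) (⌈log₂⌉-mono-≤ {2} {n} (s≤s (s≤s z≤n)))

open Combinatorics
open import Data.Integer.Base using (+_)
open import Data.Rational.Base hiding (NonZero; _÷_)
open import Data.Rational.Properties
open import Data.Rational.Solver using (module +-*-Solver)
open +-*-Solver

-- Natural numbers among the rationals

-- The inclusion, in the form that occurs in fromℕ.
ι : ℕ → ℚ
ι n = + n / 1

ι-+ : ∀ m n → ι (m ℕ.+ n) ≡ ι m + ι n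
ι-+ zero    n = sym (+-identityˡ (ι n))
ι-+ (suc m) n = begin
  ι (suc (m ℕ.+ n))     ≡⟨ suc/1 (m ℕ.+ n) ⟩
  ι (m ℕ.+ n) + 1ℚ      ≡⟨ cong (_+ 1ℚ) (ι-+ m n) ⟩
  ι m + ι n + 1ℚ        ≡⟨ solve 2 (λ m n → m :+ n :+ con 1ℚ := m :+ con 1ℚ :+ n) refl (ι m) (ι n) ⟩
  ι m + 1ℚ + ι n        ≡⟨ cong (_+ ι n) (suc/1 m) ⟨
  ι (suc m) + ι n       ∎
  where open ≡-Reasoning

ι-* : ∀ m n → ι (m ℕ.* n) ≡ ι m * ι n
ι-* zero    n = sym (*-zeroˡ (ι n))
ι-* (suc m) n = begin
  ι (n ℕ.+ m ℕ.* n)     ≡⟨ ι-+ n (m ℕ.* n) ⟩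
  ι n + ι (m ℕ.* n)     ≡⟨ cong (_+_ (ι n)) (ι-* m n) ⟩
  ι n + ι m * ι n       ≡⟨ solve 2 (λ m n → n :+ m :* n := (m :+ con 1ℚ) :* n) refl (ι m) (ι n) ⟩
  (ι m + 1ℚ) * ι n      ≡⟨ cong (_* ι n) (suc/1 m) ⟨
  ι (suc m) * ι n       ∎
  where open ≡-Reasoning

0≤ι : ∀ n → 0ℚ ≤ ι n
0≤ι zero    = ≤-refl
0≤ι (suc n) = <⇒≤ (0<n/1 (suc n))

ι-mono-≤ : ∀ {m n} → m ℕ.≤ n → ι m ≤ ι n
ι-mono-≤ {m} m≤n with ℕ.m≤n⇒∃[o]m+o≡n m≤n
... | o , refl = begin
  ι m             ≡⟨ +-identityʳ (ι m) ⟨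
  ι m + 0ℚ        ≤⟨ +-monoʳ-≤ (ι m) (0≤ι o) ⟩
  ι m + ι o       ≡⟨ ι-+ m o ⟨
  ι (m ℕ.+ o)     ∎
  where open ≤-Reasoning

ι-cancel-≤ : ∀ {m n} → ι m ≤ ι n → m ℕ.≤ n
ι-cancel-≤ {m} {n} ιm≤ιn = ℕ.≮⇒≥ λ n<m → <-irrefl refl (<-≤-trans ιn<ι1+n (≤-trans (ι-mono-≤ n<m) ιm≤ιn))
  where
  ιn<ι1+n : ι n < ι (suc n)
  ιn<ι1+n = begin-strict
    ι n           ≡⟨ +-identityʳ (ι n) ⟨
    ι n + 0ℚ      <⟨ +-monoʳ-< (ι n) (0<n/1 1) ⟩
    ι n + 1ℚ      ≡⟨ suc/1 n ⟨
    ι (suc n)     ∎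
    where open ≤-Reasoning

ι*1/suc : ∀ k → ι (suc k) * 1/suc k ≡ 1ℚ
ι*1/suc k = trans (cong (λ j → ι (suc k) * 1/suc j) (sym (ℕ.*-identityʳ k))) (scale k 0)

≤ι : ∀ p → ∃ λ n → p ≤ ι n
≤ι p@(mkℚ n d-1 _) = ℤ.∣ n ∣ , toℚᵘ-cancel-≤
  (ℚᵘ.≤-respʳ-≃ (ℚᵘ.≃-sym (toℚᵘ-fromℚᵘ (ℚᵘ.mkℚᵘ (+ ℤ.∣ n ∣) 0))) (ℚᵘ.*≤* bound))
  where
  open ℤ.≤-Reasoning
  bound : n ℤ.* + 1 ℤ.≤ + ℤ.∣ n ∣ ℤ.* + suc d-1
  bound = begin
    n ℤ.* + 1                   ≡⟨ ℤ.*-identityʳ n ⟩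
    n                           ≤⟨ i≤∣i∣ n ⟩
    + ℤ.∣ n ∣                   ≡⟨ ℤ.*-identityʳ _ ⟨
    + ℤ.∣ n ∣ ℤ.* + 1           ≤⟨ ℤ.*-monoˡ-≤-nonNeg (+ ℤ.∣ n ∣) (ℤ.+≤+ (ℕ.s≤s ℕ.z≤n)) ⟩
    + ℤ.∣ n ∣ ℤ.* + suc d-1     ∎
    where
    i≤∣i∣ : ∀ i → i ℤ.≤ + ℤ.∣ i ∣
    i≤∣i∣ (+ n)        = ℤ.≤-refl
    i≤∣i∣ (ℤ.-[1+ n ]) = ℤ.-≤+

-- The floor of a nonnegative rational; both inequalities are weak.
ι-floor : ∀ {p} → 0ℚ ≤ p → ∃ λ n → ι n ≤ p × p ≤ ι n + 1ℚ
ι-floor {p} 0≤p = let B , p≤B = ≤ι p in search B p≤B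
  where
  search : ∀ B → p ≤ ι B → ∃ λ n → ι n ≤ p × p ≤ ι n + 1ℚ
  search zero    p≤0   = 0 , 0≤p , ≤-trans p≤0 (0≤ι 1)
  search (suc B) p≤1+B with p ≤? ι B
  ... | yes p≤B = search B p≤B
  ... | no  p≰B = B , <⇒≤ (≰⇒> p≰B) , subst (p ≤_) (suc/1 B) p≤1+B

*-0≤ : ∀ {p q} → 0ℚ ≤ p → 0ℚ ≤ q → 0ℚ ≤ p * q
*-0≤ {p} {q} 0≤p 0≤q = subst (_≤ p * q) (*-zeroˡ q) (*-monoʳ-≤-nonNeg q {{nonNegative 0≤q}} 0≤p)

-- Harmonic sums and the logarithm

0≤harmonic : ∀ s l → 0ℚ ≤ harmonic s l
0≤harmonic s zero    = ≤-refl
0≤harmonic s (suc l) = +-mono-≤ (0≤harmonic s l) (<⇒≤ (1/suc-pos (s ℕ.+ l)))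

harmonic-monoʳ : ∀ s {l m} → l ℕ.≤ m → harmonic s l ≤ harmonic s m
harmonic-monoʳ s {l} l≤m with ℕ.m≤n⇒∃[o]m+o≡n l≤m
... | o , refl = begin
  harmonic s l                               ≡⟨ +-identityʳ _ ⟨
  harmonic s l + 0ℚ                          ≤⟨ +-monoʳ-≤ (harmonic s l) (0≤harmonic (s ℕ.+ l) o) ⟩
  harmonic s l + harmonic (s ℕ.+ l) o        ≡⟨ harmonic-+ s l o ⟨
  harmonic s (l ℕ.+ o)                       ∎
  where open ≤-Reasoning

harmonic-diag-mult : ∀ k c .{{_ : NonZero c}} →
  harmonic (suc k) (suc k) ≤ harmonic (suc k ℕ.* c) (suc k ℕ.* c)
harmonic-diag-mult k c@(suc c-1) =
  subst (λ s → harmonic (suc k) (suc k) ≤ harmonic s (suc k ℕ.* c)) (ℕ.*-comm c (suc k))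
    (refine-lower c-1 k (suc k))

harmonic-diag-upper : ∀ m n → harmonic n n ≤ harmonic (suc m) (suc m) + 1/suc m
harmonic-diag-upper m zero    = +-mono-≤ (0≤harmonic (suc m) (suc m)) (<⇒≤ (1/suc-pos m))
harmonic-diag-upper m (suc j) =
  subst₂ (λ x y → harmonic (suc j) x ≤ harmonic (suc m) y + 1/suc m)
    (ℕ.*-identityˡ (suc j)) (ℕ.*-identityˡ (suc m)) (logSum-close 2 j m)

-- The sum 1/(K+1) + ⋯ + 1/(2^s K) splits into s sums harmonic (2^i K) (2^i K).
harmonic-2^ : ∀ {ℓ} → (∀ n → harmonic n n ≤ ℓ) → ∀ K s →
  harmonic K (pred (2 ℕ.^ s) ℕ.* K) ≤ ι s * ℓ
harmonic-2^ {ℓ} diag≤ℓ K zero    = ≤-reflexive (sym (*-zeroˡ ℓ))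
harmonic-2^ {ℓ} diag≤ℓ K (suc s) = begin
  harmonic K (pred (2 ℕ.^ suc s) ℕ.* K)          ≡⟨ cong (harmonic K) length-eq ⟩
  harmonic K (p ℕ.* K ℕ.+ w ℕ.* K)               ≡⟨ harmonic-+ K (p ℕ.* K) (w ℕ.* K) ⟩
  harmonic K (p ℕ.* K) + harmonic (suc p ℕ.* K) (w ℕ.* K)
    ≡⟨ cong (λ x → harmonic K (p ℕ.* K) + harmonic (x ℕ.* K) (w ℕ.* K)) w≡1+p ⟨
  harmonic K (p ℕ.* K) + harmonic (w ℕ.* K) (w ℕ.* K)
    ≤⟨ +-mono-≤ (harmonic-2^ diag≤ℓ K s) (diag≤ℓ (w ℕ.* K)) ⟩
  ι s * ℓ + ℓ                                    ≡⟨ solve 2 (λ s l → s :* l :+ l := (s :+ con 1ℚ) :* l) refl (ι s) ℓ ⟩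
  (ι s + 1ℚ) * ℓ                                 ≡⟨ cong (_* ℓ) (suc/1 s) ⟨
  ι (suc s) * ℓ                                  ∎
  where
  open ≤-Reasoning
  w = 2 ℕ.^ s
  p = pred w
  w≡1+p : w ≡ suc p
  w≡1+p = sym (ℕ.suc-pred w {{ℕ.m^n≢0 2 s}})
  length-eq : pred (2 ℕ.* w) ℕ.* K ≡ p ℕ.* K ℕ.+ w ℕ.* K
  length-eq = trans
    (cong (ℕ._* K) (trans (cong (λ x → pred (2 ℕ.* x)) w≡1+p)
      (trans (lemma p) (cong (p ℕ.+_) (sym w≡1+p)))))
    (ℕ.*-distribʳ-+ K p w)
    where
    lemma : ∀ p → p ℕ.+ suc (p ℕ.+ 0) ≡ p ℕ.+ suc p
    lemma = solve-∀

-- log n ≤ ⌈log₂ n⌉ log 2, for the approximations of both logarithms.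
logSum-upper : ∀ {ℓ} → (∀ n → harmonic n n ≤ ℓ) → ∀ n j → logSum n j ≤ ι ⌈log₂ n ⌉ * ℓ
logSum-upper diag≤ℓ n j = ≤-trans
  (harmonic-monoʳ (suc j) (ℕ.*-monoˡ-≤ (suc j) (ℕ.pred-mono-≤ (n≤2^⌈log₂n⌉ n))))
  (harmonic-2^ diag≤ℓ (suc j) ⌈log₂ n ⌉)

-- The weight of one row at the optimal length

*-monoˡ : ∀ {p q r} → 0ℚ ≤ r → p ≤ q → r * p ≤ r * q
*-monoˡ {r = r} 0≤r = *-monoˡ-≤-nonNeg r {{nonNegative 0≤r}}

*-monoʳ : ∀ {p q r} → 0ℚ ≤ r → p ≤ q → p * r ≤ q * r
*-monoʳ {r = r} 0≤r = *-monoʳ-≤-nonNeg r {{nonNegative 0≤r}}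

½p≤p : ∀ {p} → 0ℚ ≤ p → ½ * p ≤ p
½p≤p {p} 0≤p = begin
  ½ * p       ≤⟨ *-monoʳ {½} {1ℚ} 0≤p (*≤* (ℤ.+≤+ (ℕ.s≤s ℕ.z≤n))) ⟩
  1ℚ * p      ≡⟨ *-identityˡ p ⟩
  p           ∎
  where open ≤-Reasoning

-- Here V stands for the weight of the row κ, b for a_n with n = I + κ, and u and
-- v for 1/κ and 1/s. The quadratic n L - κ C s n² is at least n L / 2 as long as
-- n is at most its maximiser L / (2 C κ s) = L β u v.
optimal-row : ∀ {C β L κ u s v n b V} →
  0ℚ ≤ C → 0ℚ ≤ κ → 0ℚ ≤ s → 0ℚ ≤ n →
  (C + C) * β ≡ 1ℚ → κ * u ≡ 1ℚ → s * v ≡ 1ℚ →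
  n ≤ L * β * (u * v) → b ≤ C * s * (n * n) →
  n * L ≤ V + κ * b + κ * L → ½ * (n * L) ≤ V + κ * L
optimal-row {C} {β} {L} {κ} {u} {s} {v} {n} {b} {V} 0≤C 0≤κ 0≤s 0≤n Cβ κu sv n≤y b≤ nL≤ = begin
  ½ * (n * L)                             ≡⟨ solve 2 (λ n L → con ½ :* (n :* L) := n :* L :- con ½ :* (n :* L)) refl n L ⟩
  n * L - ½ * (n * L)                     ≤⟨ +-monoˡ-≤ (- (½ * (n * L))) nL≤ ⟩
  V + κ * b + κ * L - ½ * (n * L)         ≤⟨ +-monoˡ-≤ (- (½ * (n * L))) (+-monoˡ-≤ (κ * L) (+-monoʳ-≤ V κb≤)) ⟩
  V + ½ * (n * L) + κ * L - ½ * (n * L)   ≡⟨ solve 3 (λ V x y → V :+ x :+ y :- x := V :+ y) refl V (½ * (n * L)) (κ * L) ⟩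
  V + κ * L                               ∎
  where
  open ≤-Reasoning
  κb≤ : κ * b ≤ ½ * (n * L)
  κb≤ = begin
    κ * b                                            ≤⟨ *-monoˡ 0≤κ b≤ ⟩
    κ * (C * s * (n * n))                            ≡⟨ solve 4 (λ κ C s n → κ :* (C :* s :* (n :* n)) := κ :* C :* s :* n :* n) refl κ C s n ⟩
    κ * C * s * n * n                                ≤⟨ *-monoˡ (*-0≤ (*-0≤ (*-0≤ 0≤κ 0≤C) 0≤s) 0≤n) n≤y ⟩
    κ * C * s * n * (L * β * (u * v))                ≡⟨ solve 8 (λ κ C s n L β u v →
                                                          κ :* C :* s :* n :* (L :* β :* (u :* v)) :=
                                                          con ½ :* (n :* L) :* ((C :+ C) :* β :* (κ :* u) :* (s :* v)))
                                                          refl κ C s n L β u v ⟩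
    ½ * (n * L) * ((C + C) * β * (κ * u) * (s * v))  ≡⟨ cong (½ * (n * L) *_) (cong₂ _*_ (cong₂ _*_ Cβ κu) sv) ⟩
    ½ * (n * L) * (1ℚ * 1ℚ * 1ℚ)                     ≡⟨ *-identityʳ (½ * (n * L)) ⟩
    ½ * (n * L)                                      ∎

-- If n is the floor of the maximiser y = L β w, with w = 1/(κ s), then n L / 2 is
-- at least y L / 2 - L / 2. The bound M absorbs both κ and the rounding.
optimal-row-rounded : ∀ {L β w n κ V M} → 0ℚ ≤ L → L * β * w ≤ n + 1ℚ →
  ½ * (n * L) ≤ V + κ * L → κ ≤ M → ½ ≤ M → ½ * (L * L * β) * w ≤ V + (M + M) * L
optimal-row-rounded {L} {β} {w} {n} {κ} {V} {M} 0≤L y≤n+1 half≤ κ≤M ½≤M = begin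
  ½ * (L * L * β) * w          ≡⟨ solve 3 (λ L β w → con ½ :* (L :* L :* β) :* w := con ½ :* L :* (L :* β :* w)) refl L β w ⟩
  ½ * L * (L * β * w)          ≤⟨ *-monoˡ (*-0≤ (<⇒≤ 0<½) 0≤L) y≤n+1 ⟩
  ½ * L * (n + 1ℚ)             ≡⟨ solve 2 (λ L n → con ½ :* L :* (n :+ con 1ℚ) := con ½ :* (n :* L) :+ con ½ :* L) refl L n ⟩
  ½ * (n * L) + ½ * L          ≤⟨ +-mono-≤ half≤ (*-monoʳ 0≤L ½≤M) ⟩
  V + κ * L + M * L            ≤⟨ +-monoˡ-≤ (M * L) (+-monoʳ-≤ V (*-monoʳ 0≤L κ≤M)) ⟩
  V + M * L + M * L            ≡⟨ solve 3 (λ V M L → V :+ M :* L :+ M :* L := V :+ (M :+ M) :* L) refl V M L ⟩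
  V + (M + M) * L              ∎
  where open ≤-Reasoning

-- Summation over dyadic blocks

doubling : ∀ q w → q ℕ.* w ℕ.+ q ℕ.* w ≡ q ℕ.* (2 ℕ.* w)
doubling = solve-∀

-- The t-th block consists of the k with Q 2^t ≤ k < Q 2^(t+1); it stands for the
-- index differences κ = k + 1.
module DyadicBlocks (Q : ℕ) (V : ℕ → ℕ) {α e λ₀ : ℚ} (0≤α : 0ℚ ≤ α) (0≤e : 0ℚ ≤ e)
              (λ₀≤block : ∀ t → λ₀ ≤ harmonic (Q ℕ.* 2 ℕ.^ t) (Q ℕ.* 2 ℕ.^ t)) where

  -- Row k + 1 weighs at least α / ((k + 1) (s′ + 1)), up to the error e.
  Bound : ℕ → ℕ → Set
  Bound s′ k = α * (1/suc k * 1/suc s′) ≤ ι (V k) + e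

  block-sum : ∀ s′ P l → (∀ i → i ℕ.< l → Bound s′ (P ℕ.+ i)) →
    α * (harmonic P l * 1/suc s′) ≤ ι (∑ l (λ i → V (P ℕ.+ i))) + ι l * e
  block-sum s′ P zero    bound = ≤-reflexive
    (solve 3 (λ α v e → α :* (con 0ℚ :* v) := con 0ℚ :+ con 0ℚ :* e) refl α (1/suc s′) e)
  block-sum s′ P (suc l) bound = begin
    α * ((harmonic P l + u) * v)                     ≡⟨ solve 4 (λ α h u v → α :* ((h :+ u) :* v) := α :* (h :* v) :+ α :* (u :* v)) refl α (harmonic P l) u v ⟩
    α * (harmonic P l * v) + α * (u * v)             ≤⟨ +-mono-≤ (block-sum s′ P l (λ i i<l → bound i (ℕ.m<n⇒m<1+n i<l))) (bound l (ℕ.n<1+n l)) ⟩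
    ι Σ + ι l * e + (ι (V (P ℕ.+ l)) + e)            ≡⟨ solve 4 (λ S l x e → S :+ l :* e :+ (x :+ e) := S :+ x :+ (l :+ con 1ℚ) :* e) refl (ι Σ) (ι l) (ι (V (P ℕ.+ l))) e ⟩
    ι Σ + ι (V (P ℕ.+ l)) + (ι l + 1ℚ) * e           ≡⟨ cong₂ (λ x y → x + y * e) (ι-+ Σ (V (P ℕ.+ l))) (suc/1 l) ⟨
    ι (Σ ℕ.+ V (P ℕ.+ l)) + ι (suc l) * e            ∎
    where
    open ≤-Reasoning
    Σ = ∑ l (λ i → V (P ℕ.+ i))
    u = 1/suc (P ℕ.+ l)
    v = 1/suc s′

  -- Block t is used with s = S + T - t, so s runs over S + 1, …, S + T, and the
  -- last block t = T - 1 contributes the first term of harmonic S T.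
  dyadic-sum : ∀ T S →
    (∀ t s′ → t ℕ.+ suc s′ ≡ S ℕ.+ T → t ℕ.< T → ∀ i → i ℕ.< Q ℕ.* 2 ℕ.^ t → Bound s′ (Q ℕ.* 2 ℕ.^ t ℕ.+ i)) →
    α * (λ₀ * harmonic S T) ≤ ι (∑ (Q ℕ.* 2 ℕ.^ T) V) + ι (Q ℕ.* 2 ℕ.^ T) * e
  dyadic-sum zero    S bound = begin
    α * (λ₀ * 0ℚ)       ≡⟨ solve 2 (λ α l → α :* (l :* con 0ℚ) := con 0ℚ) refl α λ₀ ⟩
    0ℚ                  ≤⟨ +-mono-≤ (0≤ι (∑ (Q ℕ.* 1) V)) (*-0≤ (0≤ι (Q ℕ.* 1)) 0≤e) ⟩
    ι (∑ (Q ℕ.* 1) V) + ι (Q ℕ.* 1) * e ∎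
    where open ≤-Reasoning
  dyadic-sum (suc T) S bound = begin
    α * (λ₀ * harmonic S (suc T))
      ≡⟨ cong (λ h → α * (λ₀ * h)) first-term ⟩
    α * (λ₀ * (harmonic (suc S) T + v))
      ≡⟨ solve 4 (λ α l h v → α :* (l :* (h :+ v)) := α :* (l :* h) :+ α :* (l :* v)) refl α λ₀ (harmonic (suc S) T) v ⟩
    α * (λ₀ * harmonic (suc S) T) + α * (λ₀ * v)
      ≤⟨ +-mono-≤ (dyadic-sum T (suc S) λ t s′ eq t<T → bound t s′ (trans eq (sym (ℕ.+-suc S T))) (ℕ.m<n⇒m<1+n t<T))
           (*-monoˡ 0≤α (*-monoʳ (<⇒≤ (1/suc-pos S)) (λ₀≤block T))) ⟩
    ι (∑ P V) + ι P * e + α * (harmonic P P * v)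
      ≤⟨ +-monoʳ-≤ (ι (∑ P V) + ι P * e) (block-sum S P P (bound T S T+1+S≡ (ℕ.n<1+n T))) ⟩
    ι (∑ P V) + ι P * e + (ι (∑ P (λ i → V (P ℕ.+ i))) + ι P * e)
      ≡⟨ solve 4 (λ A B p e → A :+ p :* e :+ (B :+ p :* e) := A :+ B :+ (p :+ p) :* e) refl (ι (∑ P V)) (ι (∑ P (λ i → V (P ℕ.+ i)))) (ι P) e ⟩
    ι (∑ P V) + ι (∑ P (λ i → V (P ℕ.+ i))) + (ι P + ι P) * e
      ≡⟨ cong₂ (λ x y → x + y * e) (ι-+ (∑ P V) (∑ P (λ i → V (P ℕ.+ i)))) (ι-+ P P) ⟨
    ι (∑ P V ℕ.+ ∑ P (λ i → V (P ℕ.+ i))) + ι (P ℕ.+ P) * e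
      ≡⟨ cong (λ x → ι x + ι (P ℕ.+ P) * e) (∑-split P P V) ⟨
    ι (∑ (P ℕ.+ P) V) + ι (P ℕ.+ P) * e
      ≡⟨ cong (λ x → ι (∑ x V) + ι x * e) (doubling Q (2 ℕ.^ T)) ⟩
    ι (∑ (Q ℕ.* 2 ℕ.^ suc T) V) + ι (Q ℕ.* 2 ℕ.^ suc T) * e ∎
    where
    open ≤-Reasoning
    P = Q ℕ.* 2 ℕ.^ T
    v = 1/suc S
    T+1+S≡ : T ℕ.+ suc S ≡ S ℕ.+ suc T
    T+1+S≡ = trans (ℕ.+-suc T S) (trans (cong suc (ℕ.+-comm T S)) (sym (ℕ.+-suc S T)))
    first-term : harmonic S (suc T) ≡ harmonic (suc S) T + v
    first-term = trans (harmonic-+ S 1 T) (trans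
      (cong₂ (λ i j → 0ℚ + 1/suc i + harmonic j T) (ℕ.+-identityʳ S) (ℕ.+-comm S 1))
      (solve 2 (λ u h → con 0ℚ :+ u :+ h := h :+ u) refl v (harmonic (suc S) T)))

-- The inequality at one scale

-- The whole argument for one choice of parameters, under the assumption that
-- a_n ≤ C ⌈log₂ n⌉ n² for all n with Q ≤ n ≤ 4^T, where Q = m + 1. As every κ
-- in use exceeds Q, so does every n ≥ κ in use, and no assumption on the smaller
-- n is needed.
module SingleScale
  {g A a} (golomb : IsGolombRuler g A) (enum : IsIncreasingEnumeration A a)
  {C β} (0≤C : 0ℚ ≤ C) (0≤β : 0ℚ ≤ β) (2Cβ≡1 : (C + C) * β ≡ 1ℚ)
  (m T J : ℕ) (0<J : 0 ℕ.< J)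
  (λ₀≤H : harmonic (suc m) (suc m) ≤ harmonic T T)
  (Jβ≤T : ι J * β ≤ ι T)
  (growth : ∀ n → suc m ℕ.≤ n → n ℕ.≤ 2 ℕ.^ (T ℕ.+ T) → ι (a (pred n)) ≤ C * ι ⌈log₂ n ⌉ * (ι n * ι n))
  where

  open Ruler golomb enum

  -- M is the number of rows, R a common length of the rows that is no smaller
  -- than any optimal length, and L the cut-off of the distances.
  Q M L R : ℕ
  Q = suc m
  M = Q ℕ.* 2 ℕ.^ T
  R = 2 ℕ.^ (T ℕ.+ T)
  L = Q ℕ.* R ℕ.* J

  λ₀ : ℚ
  λ₀ = harmonic Q Q

  -- The maximiser L / (2 C κ s), with κ = k + 1 and s = s′ + 1.
  y : ℕ → ℕ → ℚ
  y k s′ = ι L * β * (1/suc k * 1/suc s′)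

  y≤2^s : ∀ {t s′ k} → t ℕ.+ suc s′ ≡ T ℕ.+ T → T ℕ.≤ suc s′ → Q ℕ.* 2 ℕ.^ t ℕ.≤ k →
    y k s′ ≤ ι (2 ℕ.^ suc s′)
  y≤2^s {t} {s′} {k} t+s≡2T T≤s P≤k = begin
    ι L * β * (u * v)                           ≡⟨ cong (λ l → ι l * β * (u * v)) L≡ ⟩
    ι (P ℕ.* W ℕ.* J) * β * (u * v)             ≡⟨ cong (λ l → l * β * (u * v)) (trans (ι-* (P ℕ.* W) J) (cong (_* ι J) (ι-* P W))) ⟩
    ι P * ι W * ι J * β * (u * v)               ≡⟨ solve 6 (λ P W J β u v → P :* W :* J :* β :* (u :* v) := P :* u :* (J :* β :* v) :* W) refl (ι P) (ι W) (ι J) β u v ⟩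
    ι P * u * (ι J * β * v) * ι W               ≤⟨ *-monoʳ (0≤ι W) (*-mono (*-0≤ (0≤ι P) 0≤u) (<⇒≤ (0<n/1 1)) Pu≤1 Jβv≤1) ⟩
    1ℚ * 1ℚ * ι W                               ≡⟨ *-identityˡ (ι W) ⟩
    ι W                                         ∎
    where
    open ≤-Reasoning
    P = Q ℕ.* 2 ℕ.^ t
    W = 2 ℕ.^ suc s′
    u = 1/suc k
    v = 1/suc s′
    0≤u = <⇒≤ (1/suc-pos k)
    0≤v = <⇒≤ (1/suc-pos s′)
    L≡ : L ≡ P ℕ.* W ℕ.* J
    L≡ = cong (ℕ._* J) (trans (cong (Q ℕ.*_) (trans (cong (2 ℕ.^_) (sym t+s≡2T)) (ℕ.^-distribˡ-+-* 2 t (suc s′))))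
           (sym (ℕ.*-assoc Q (2 ℕ.^ t) W)))
    Pu≤1 : ι P * u ≤ 1ℚ
    Pu≤1 = ≤-trans (*-monoʳ 0≤u (ι-mono-≤ (ℕ.m≤n⇒m≤1+n P≤k))) (≤-reflexive (ι*1/suc k))
    Jβv≤1 : ι J * β * v ≤ 1ℚ
    Jβv≤1 = ≤-trans (*-monoʳ 0≤v (≤-trans Jβ≤T (ι-mono-≤ T≤s))) (≤-reflexive (ι*1/suc s′))

  row-long : ∀ {t s′ k} I → t ℕ.+ suc s′ ≡ T ℕ.+ T → T ℕ.≤ suc s′ → Q ℕ.* 2 ℕ.^ t ℕ.≤ k →
    ι (suc k ℕ.+ I) ≤ y k s′ → ½ * (ι (suc k ℕ.+ I) * ι L) ≤ ι (rowWeight L R k) + ι (suc k) * ι L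
  row-long {t} {s′} {k} I t+s≡2T T≤s P≤k n≤y =
    optimal-row {C} {β} {ι L} {ι (suc k)} {1/suc k} {ι (suc s′)} {1/suc s′} {ι n} {ι (a (I ℕ.+ k))} {ι (rowWeight L R k)}
      0≤C (0≤ι (suc k)) (0≤ι (suc s′)) (0≤ι n) 2Cβ≡1 (ι*1/suc k) (ι*1/suc s′) n≤y a≤ nL≤
    where
    open ≤-Reasoning
    κ = suc k
    n = κ ℕ.+ I
    κ≤n = ℕ.m≤m+n κ I
    n≤2^s : n ℕ.≤ 2 ℕ.^ suc s′
    n≤2^s = ι-cancel-≤ (≤-trans n≤y (y≤2^s {t} t+s≡2T T≤s P≤k))
    n≤R : n ℕ.≤ R
    n≤R = ℕ.≤-trans n≤2^s (ℕ.^-monoʳ-≤ 2 (subst (suc s′ ℕ.≤_) t+s≡2T (ℕ.m≤n+m (suc s′) t)))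
    Q≤n : Q ℕ.≤ n
    Q≤n = ℕ.≤-trans (ℕ.m≤m*n Q (2 ℕ.^ t) {{ℕ.m^n≢0 2 t}}) (ℕ.≤-trans P≤k (ℕ.≤-trans (ℕ.n≤1+n k) κ≤n))
    logn≤s : ⌈log₂ n ⌉ ℕ.≤ suc s′
    logn≤s = subst (⌈log₂ n ⌉ ℕ.≤_) (⌈log₂2^n⌉≡n (suc s′)) (⌈log₂⌉-mono-≤ n≤2^s)
    a≤ : ι (a (I ℕ.+ k)) ≤ C * ι (suc s′) * (ι n * ι n)
    a≤ = begin
      ι (a (I ℕ.+ k))                      ≡⟨ cong (λ j → ι (a j)) (ℕ.+-comm I k) ⟩
      ι (a (pred n))                       ≤⟨ growth n Q≤n n≤R ⟩
      C * ι ⌈log₂ n ⌉ * (ι n * ι n)        ≤⟨ *-monoʳ (*-0≤ (0≤ι n) (0≤ι n)) (*-monoˡ 0≤C (ι-mono-≤ logn≤s)) ⟩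
      C * ι (suc s′) * (ι n * ι n)         ∎
    nL≤ : ι n * ι L ≤ ι (rowWeight L R k) + ι κ * ι (a (I ℕ.+ k)) + ι κ * ι L
    nL≤ = begin
      ι (κ ℕ.+ I) * ι L                    ≡⟨ cong (_* ι L) (ι-+ κ I) ⟩
      (ι κ + ι I) * ι L                    ≡⟨ solve 3 (λ κ I L → (κ :+ I) :* L := I :* L :+ κ :* L) refl (ι κ) (ι I) (ι L) ⟩
      ι I * ι L + ι κ * ι L                ≡⟨ cong (_+ ι κ * ι L) (ι-* I L) ⟨
      ι (I ℕ.* L) + ι κ * ι L              ≤⟨ +-monoˡ-≤ (ι κ * ι L) (ι-mono-≤ (rowWeight-lower L k {I} {R} (ℕ.≤-trans (ℕ.m≤n+m I κ) n≤R))) ⟩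
      ι (rowWeight L R k ℕ.+ κ ℕ.* a (I ℕ.+ k)) + ι κ * ι L
        ≡⟨ cong (_+ ι κ * ι L) (trans (ι-+ (rowWeight L R k) _) (cong (_+_ (ι (rowWeight L R k))) (ι-* κ (a (I ℕ.+ k))))) ⟩
      ι (rowWeight L R k) + ι κ * ι (a (I ℕ.+ k)) + ι κ * ι L ∎

  -- If n ≤ κ, no pair is needed, because the error term κ L is already enough.
  row-short : ∀ {k n} → n ℕ.≤ suc k → ½ * (ι n * ι L) ≤ ι (rowWeight L R k) + ι (suc k) * ι L
  row-short {k} {n} n≤κ = begin
    ½ * (ι n * ι L)                     ≤⟨ *-monoˡ (<⇒≤ 0<½) (*-monoʳ (0≤ι L) (ι-mono-≤ n≤κ)) ⟩
    ½ * (ι (suc k) * ι L)               ≤⟨ ½p≤p (*-0≤ (0≤ι (suc k)) (0≤ι L)) ⟩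
    ι (suc k) * ι L                     ≡⟨ +-identityˡ (ι (suc k) * ι L) ⟨
    0ℚ + ι (suc k) * ι L                ≤⟨ +-monoˡ-≤ (ι (suc k) * ι L) (0≤ι (rowWeight L R k)) ⟩
    ι (rowWeight L R k) + ι (suc k) * ι L ∎
    where open ≤-Reasoning

  half-row : ∀ {t s′ k n} → t ℕ.+ suc s′ ≡ T ℕ.+ T → T ℕ.≤ suc s′ → Q ℕ.* 2 ℕ.^ t ℕ.≤ k →
    ι n ≤ y k s′ → ½ * (ι n * ι L) ≤ ι (rowWeight L R k) + ι (suc k) * ι L
  half-row {t} {s′} {k} {n} t+s≡2T T≤s P≤k n≤y = [ row-short , split ]′ (ℕ.≤-total n (suc k))
    where
    split : suc k ℕ.≤ n → ½ * (ι n * ι L) ≤ ι (rowWeight L R k) + ι (suc k) * ι L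
    split κ≤n = let I , κ+I≡n = ℕ.m≤n⇒∃[o]m+o≡n κ≤n in
      subst (λ n → ½ * (ι n * ι L) ≤ ι (rowWeight L R k) + ι (suc k) * ι L) κ+I≡n
        (row-long I t+s≡2T T≤s P≤k (subst (λ n → ι n ≤ y k s′) (sym κ+I≡n) n≤y))

  α loss : ℚ
  α = ½ * (ι L * ι L * β)
  loss = (ι M + ι M) * ι L

  0≤α : 0ℚ ≤ α
  0≤α = *-0≤ (<⇒≤ 0<½) (*-0≤ (*-0≤ (0≤ι L) (0≤ι L)) 0≤β)

  0≤loss : 0ℚ ≤ loss
  0≤loss = *-0≤ (+-mono-≤ (0≤ι M) (0≤ι M)) (0≤ι L)

  open DyadicBlocks Q (rowWeight L R) {λ₀ = λ₀} 0≤α 0≤loss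
    (λ t → harmonic-diag-mult m (2 ℕ.^ t) {{ℕ.m^n≢0 2 t}})

  row-bound : ∀ t s′ → t ℕ.+ suc s′ ≡ T ℕ.+ T → t ℕ.< T → ∀ i → i ℕ.< Q ℕ.* 2 ℕ.^ t →
    Bound s′ (Q ℕ.* 2 ℕ.^ t ℕ.+ i)
  row-bound t s′ t+s≡2T t<T i i<P = let n , n≤y , y≤n+1 = ι-floor 0≤y in
    optimal-row-rounded {ι L} {β} {1/suc k * 1/suc s′} {ι n} {ι (suc k)} {ι (rowWeight L R k)} {ι M} (0≤ι L) y≤n+1
      (half-row {t} {s′} {k} {n} t+s≡2T T≤s (ℕ.m≤m+n P i) n≤y)
      (ι-mono-≤ κ≤M) ½≤ιM
    where
    P = Q ℕ.* 2 ℕ.^ t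
    k = P ℕ.+ i
    T≤s : T ℕ.≤ suc s′
    T≤s = ℕ.+-cancelˡ-≤ T T (suc s′) (ℕ.≤-trans (ℕ.≤-reflexive (sym t+s≡2T)) (ℕ.+-monoˡ-≤ (suc s′) (ℕ.<⇒≤ t<T)))
    κ≤M : suc k ℕ.≤ M
    κ≤M = let open ℕ.≤-Reasoning in begin
      suc (P ℕ.+ i)           ≤⟨ ℕ.+-monoʳ-< P i<P ⟩
      P ℕ.+ P                 ≡⟨ doubling Q (2 ℕ.^ t) ⟩
      Q ℕ.* 2 ℕ.^ suc t       ≤⟨ ℕ.*-monoʳ-≤ Q (ℕ.^-monoʳ-≤ 2 t<T) ⟩
      M                       ∎
    0≤y : 0ℚ ≤ y k s′
    0≤y = *-0≤ (*-0≤ (0≤ι L) 0≤β) (*-0≤ (<⇒≤ (1/suc-pos k)) (<⇒≤ (1/suc-pos s′)))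
    1≤M : 1 ℕ.≤ M
    1≤M = ℕ.≤-trans (ℕ.s≤s ℕ.z≤n) κ≤M
    ½≤ιM : ½ ≤ ι M
    ½≤ιM = ≤-trans {½} {ι 1} (*≤* (ℤ.+≤+ (ℕ.s≤s ℕ.z≤n))) (ι-mono-≤ 1≤M)

  L≢0 : ℕ.NonZero L
  L≢0 = ℕ.m*n≢0 (Q ℕ.* R) J {{ℕ.m*n≢0 Q R {{_}} {{ℕ.m^n≢0 2 (T ℕ.+ T)}}}} {{ℕ.>-nonZero 0<J}}

  M*M*J≡Q*L : M ℕ.* M ℕ.* J ≡ Q ℕ.* L
  M*M*J≡Q*L = trans (lemma Q (2 ℕ.^ T) J) (cong (λ r → Q ℕ.* (Q ℕ.* r ℕ.* J)) (sym (ℕ.^-distribˡ-+-* 2 T T)))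
    where
    lemma : ∀ q w j → q ℕ.* w ℕ.* (q ℕ.* w) ℕ.* j ≡ q ℕ.* (q ℕ.* (w ℕ.* w) ℕ.* j)
    lemma = solve-∀

  -- The three bounds together give ½ L² β λ₀² ≤ ½ g L² + 2 M² L. The error term
  -- is of lower order in J because M² J = Q L.
  scale-inequality : ι J * (β * (λ₀ * λ₀)) ≤ ι J * ι g + ι 4 * ι Q
  scale-inequality = *-cancelˡ-≤-pos (ι L * ι L) {{positive (*-0< 0<L 0<L)}} (begin
    l * l * (j * (β * (λ₀ * λ₀)))             ≡⟨ solve 4 (λ l j β h → l :* l :* (j :* (β :* (h :* h))) := (j :+ j) :* (con ½ :* (l :* l :* β) :* (h :* h))) refl l j β λ₀ ⟩
    (j + j) * (α * (λ₀ * λ₀))                 ≤⟨ *-monoˡ 0≤2j (*-monoˡ 0≤α (*-monoˡ (0≤harmonic Q Q) λ₀≤H)) ⟩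
    (j + j) * (α * (λ₀ * harmonic T T))       ≤⟨ *-monoˡ 0≤2j (dyadic-sum T T row-bound) ⟩
    (j + j) * (σ + ι M * ((ι M + ι M) * l))   ≡⟨ solve 4 (λ j σ μ l → (j :+ j) :* (σ :+ μ :* ((μ :+ μ) :* l)) := j :* (con (ι 2) :* σ) :+ con (ι 4) :* (μ :* μ :* j) :* l) refl j σ (ι M) l ⟩
    j * (ι 2 * σ) + ι 4 * (ι M * ι M * j) * l ≤⟨ +-mono-≤ (*-monoˡ (0≤ι J) 2σ≤) (≤-reflexive (cong (λ x → ι 4 * x * l) MMJ)) ⟩
    j * (ι g * (l * l)) + ι 4 * (ι Q * l) * l ≡⟨ solve 5 (λ j g l f q → j :* (g :* (l :* l)) :+ f :* (q :* l) :* l := l :* l :* (j :* g :+ f :* q)) refl j (ι g) l (ι 4) (ι Q) ⟩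
    l * l * (j * ι g + ι 4 * ι Q)             ∎)
    where
    open ≤-Reasoning
    l = ι L
    j = ι J
    σ = ι (∑ M (rowWeight L R))
    0<L : 0ℚ < l
    0<L = 0<n/1 L {{L≢0}}
    0≤2j = +-mono-≤ (0≤ι J) (0≤ι J)
    2σ≤ : ι 2 * σ ≤ ι g * (l * l)
    2σ≤ = begin
      ι 2 * σ                          ≡⟨ ι-* 2 (∑ M (rowWeight L R)) ⟨
      ι (2 ℕ.* ∑ M (rowWeight L R))    ≤⟨ ι-mono-≤ (∑-rowWeight-upper L M R) ⟩
      ι (g ℕ.* (L ℕ.* L))              ≡⟨ trans (ι-* g (L ℕ.* L)) (cong (ι g *_) (ι-* L L)) ⟩
      ι g * (l * l)                    ∎
    MMJ : ι M * ι M * j ≡ ι Q * l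
    MMJ = trans (cong (_* j) (sym (ι-* M M))) (trans (sym (ι-* (M ℕ.* M) J)) (trans (cong ι M*M*J≡Q*L) (ι-* Q L)))

-- Quotients of reals compared with rationals

÷-lower : ∀ {x y q r} {{0<y : 0ℝ Defs.< y}} → q < r → (∀ i j → r * seq y j ≤ seq x i) →
  fromℚ q Defs.< x ÷ y
÷-lower {x} {y} {q} {r} {{0<y}} q<r ry≤x = mk< (r - q) 0<r-q 0 λ n _ → begin
  q + (r - q)                  ≡⟨ solve 2 (λ q r → q :+ (r :- q) := r) refl q r ⟩
  r                            ≡⟨ *-identityʳ r ⟨
  r * 1ℚ                       ≡⟨ cong (r *_) (tail*1/tail n) ⟨
  r * (tail n * 1/tail n)      ≡⟨ *-assoc r (tail n) (1/tail n) ⟨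
  r * tail n * 1/tail n        ≤⟨ *-monoʳ (<⇒≤ (0<1/tail n)) (ry≤x n _) ⟩
  seq x n * 1/tail n           ∎
  where
  open ≤-Reasoning
  open Reciprocal y 0<y
  0<r-q : 0ℚ < r - q
  0<r-q = subst (_< r - q) (+-inverseʳ q) (+-monoˡ-< (- q) q<r)

÷-upper : ∀ {x y c q} {{0<y : 0ℝ Defs.< y}} → (∀ j → seq y j ≡ c) → fromℚ q Defs.< x ÷ y →
  ∃ λ δ → 0ℚ < δ × ∃ λ N → ∀ n → N ℕ.≤ n → (q + δ) * c ≤ seq x n
÷-upper {x} {y} {c} {q} {{0<y}} y≡c (mk< δ 0<δ N q+δ≤) = δ , 0<δ , N , λ n N≤n → begin
  (q + δ) * c                       ≡⟨ cong ((q + δ) *_) (y≡c _) ⟨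
  (q + δ) * tail n                  ≤⟨ *-monoʳ (<⇒≤ (0<tail n)) (q+δ≤ n N≤n) ⟩
  seq x n * 1/tail n * tail n       ≡⟨ solve 3 (λ x u t → x :* u :* t := x :* (t :* u)) refl (seq x n) (1/tail n) (tail n) ⟩
  seq x n * (tail n * 1/tail n)     ≡⟨ cong (seq x n *_) (tail*1/tail n) ⟩
  seq x n * 1ℚ                      ≡⟨ *-identityʳ (seq x n) ⟩
  seq x n                           ∎
  where
  open ≤-Reasoning
  open Reciprocal y 0<y

-- From the single scale to the limit superior

exceeds : ∀ {x γ} → 0ℚ < γ → ∃ λ J → x < ι (suc J) * γ
exceeds {x} {γ} 0<γ = let J , x/γ≤J = ≤ι (x * γ⁻¹) in J , (begin-strict
  x                       ≡⟨ *-identityʳ x ⟨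
  x * 1ℚ                  ≡⟨ cong (x *_) (*-inverseˡ γ {{>-nonZero 0<γ}}) ⟨
  x * (γ⁻¹ * γ)           ≡⟨ *-assoc x γ⁻¹ γ ⟨
  x * γ⁻¹ * γ             ≤⟨ *-monoʳ (<⇒≤ 0<γ) x/γ≤J ⟩
  ι J * γ                 ≡⟨ +-identityʳ (ι J * γ) ⟨
  ι J * γ + 0ℚ            <⟨ +-monoʳ-< (ι J * γ) 0<γ ⟩
  ι J * γ + γ             ≡⟨ solve 2 (λ j γ → j :* γ :+ γ := (j :+ con 1ℚ) :* γ) refl (ι J) γ ⟩
  (ι J + 1ℚ) * γ          ≡⟨ cong (_* γ) (suc/1 J) ⟨
  ι (suc J) * γ           ∎)
  where
  open ≤-Reasoning
  γ⁻¹ = (1/ γ) {{>-nonZero 0<γ}}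

-- With G = 2 g, λ₀ just below log 2 and λ₀ + u just above it: if 2 g r < log 2
-- with room to spare, then 2 g C < λ₀² for C = r (λ₀ + u).
constant-margin : ∀ {G r δ λ₀ u} → 1ℚ ≤ G → 0ℚ < r → 0ℚ < δ → (r + δ) * G ≤ λ₀ → u < δ →
  G * (r * (λ₀ + u)) < λ₀ * λ₀
constant-margin {G} {r} {δ} {λ₀} {u} 1≤G 0<r 0<δ Gr≤λ₀ u<δ = begin-strict
  G * (r * (λ₀ + u))         <⟨ *-monoʳ-<-pos G {{positive 0<G}} (*-monoʳ-<-pos r {{positive 0<r}} (+-monoʳ-< λ₀ u<δ)) ⟩
  G * (r * (λ₀ + δ))         ≡⟨ solve 4 (λ G r l d → G :* (r :* (l :+ d)) := G :* (r :* l) :+ G :* d :* r) refl G r λ₀ δ ⟩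
  G * (r * λ₀) + G * δ * r   ≤⟨ +-monoʳ-≤ (G * (r * λ₀)) (*-monoˡ (<⇒≤ (*-0< 0<G 0<δ)) r≤λ₀) ⟩
  G * (r * λ₀) + G * δ * λ₀  ≡⟨ solve 4 (λ G r l d → G :* (r :* l) :+ G :* d :* l := (r :+ d) :* G :* l) refl G r λ₀ δ ⟩
  (r + δ) * G * λ₀           ≤⟨ *-monoʳ (≤-trans (<⇒≤ 0<r) r≤λ₀) Gr≤λ₀ ⟩
  λ₀ * λ₀                    ∎
  where
  open ≤-Reasoning
  0<G : 0ℚ < G
  0<G = <-≤-trans (0<n/1 1) 1≤G
  r≤λ₀ : r ≤ λ₀
  r≤λ₀ = begin
    r                  ≡⟨ +-identityʳ r ⟨
    r + 0ℚ             ≤⟨ +-monoʳ-≤ r (<⇒≤ 0<δ) ⟩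
    r + δ              ≡⟨ *-identityʳ (r + δ) ⟨
    (r + δ) * 1ℚ       ≤⟨ *-monoˡ (+-mono-≤ (<⇒≤ 0<r) (<⇒≤ 0<δ)) 1≤G ⟩
    (r + δ) * G        ≤⟨ Gr≤λ₀ ⟩
    λ₀                 ∎

module _ (a : ℕ → ℕ) where

  -- The bound C ⌈log₂ n⌉ n² for the n-th element a (pred n).
  allowance : ℚ → ℕ → ℚ
  allowance C n = C * ι ⌈log₂ n ⌉ * (ι n * ι n)

  Fast : ℚ → ℕ → Set
  Fast C n = allowance C n < ι (a (pred n))

  fast-or-bounded : ∀ C lo hi → (∃ λ n → lo ℕ.≤ n × Fast C n) ⊎
    (∀ n → lo ℕ.≤ n → n ℕ.≤ hi → ι (a (pred n)) ≤ allowance C n)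
  fast-or-bounded C lo hi = decide (ℕ.anyUpTo? (λ n → (lo ℕ.≤? n) ×-dec (allowance C n <? ι (a (pred n)))) (suc hi))
    where
    decide : Dec (∃ λ n → n ℕ.< suc hi × lo ℕ.≤ n × Fast C n) → _
    decide (yes (n , _ , found)) = inj₁ (n , found)
    decide (no none) = inj₂ λ n lo≤n n≤hi → ≮⇒≥ λ fast → none (n , ℕ.s≤s n≤hi , lo≤n , fast)

  -- The terms a_n / (n² log n) for n = k + 2.
  ratio : ℕ → ℝ
  ratio k = let n = suc (suc k) in fromℕ (a (pred n)) ÷ (fromℕ n Defs.* fromℕ n Defs.* log n)

  fast⇒ratio : ∀ {q r ℓ} k → q < r → 0ℚ ≤ r → (∀ n → harmonic n n ≤ ℓ) → Fast (r * ℓ) (suc (suc k)) →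
    fromℚ q Defs.< ratio k
  fast⇒ratio {q} {r} {ℓ} k q<r 0≤r diag≤ℓ fast = ÷-lower {r = r} q<r λ _ j → begin
    r * (ι n * ι n * logSum n j)                  ≤⟨ *-monoˡ 0≤r (*-monoˡ (*-0≤ (0≤ι n) (0≤ι n)) (logSum-upper diag≤ℓ n j)) ⟩
    r * (ι n * ι n * (ι ⌈log₂ n ⌉ * ℓ))           ≡⟨ solve 4 (λ r n s l → r :* (n :* n :* (s :* l)) := r :* l :* s :* (n :* n)) refl r (ι n) (ι ⌈log₂ n ⌉) ℓ ⟩
    r * ℓ * ι ⌈log₂ n ⌉ * (ι n * ι n)             ≤⟨ <⇒≤ fast ⟩
    ι (a (pred n))                                ∎
    where
    open ≤-Reasoning
    n = suc (suc k)

  ratio-nonneg : ∀ {q} k → q < 0ℚ → fromℚ q Defs.< ratio k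
  ratio-nonneg k q<0 = ÷-lower {r = 0ℚ} q<0 λ _ j →
    ≤-trans (≤-reflexive (*-zeroˡ (ι n * ι n * logSum n j))) (0≤ι (a (suc k)))
    where n = suc (suc k)

-- If r + δ ≤ log 2 / (2 g), then a_n exceeds C ⌈log₂ n⌉ n² for some n ≥ Q = m + 1,
-- where C is close to r log 2.
module Frequently
  {g A a} (golomb : IsGolombRuler g A) (enum : IsIncreasingEnumeration A a)
  {r δ} (0<r : 0ℚ < r) (0<δ : 0ℚ < δ) (1≤g : 1 ℕ.≤ g)
  (m : ℕ) (1/Q<δ : 1/suc m < δ)
  (r+δ≤ : (r + δ) * (ι 2 * ι g) ≤ harmonic (suc m) (suc m))
  where

  -- λ₀ and ℓ approximate log 2; ℓ bounds every harmonic n n from above.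
  λ₀ ℓ C : ℚ
  λ₀ = harmonic (suc m) (suc m)
  ℓ = λ₀ + 1/suc m
  C = r * ℓ

  0<C : 0ℚ < C
  0<C = *-0< 0<r (subst (_< ℓ) (+-identityˡ 0ℚ) (+-mono-≤-< (0≤harmonic (suc m) (suc m)) (1/suc-pos m)))

  0<2C : 0ℚ < C + C
  0<2C = subst (_< C + C) (+-identityˡ 0ℚ) (+-mono-< 0<C 0<C)

  β : ℚ
  β = (1/ (C + C)) {{>-nonZero 0<2C}}

  0<β : 0ℚ < β
  0<β = 1/-0< 0<2C

  2Cβ≡1 : (C + C) * β ≡ 1ℚ
  2Cβ≡1 = *-inverseʳ (C + C) {{>-nonZero 0<2C}}

  -- The scale inequality reads J γ ≤ 4 Q.
  γ : ℚ
  γ = β * (λ₀ * λ₀) - ι g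

  1≤2g : 1ℚ ≤ ι 2 * ι g
  1≤2g = subst (1ℚ ≤_) (ι-* 2 g) (ι-mono-≤ (ℕ.≤-trans 1≤g (ℕ.m≤n*m g 2)))

  0<γ : 0ℚ < γ
  0<γ = begin-strict
    0ℚ                                       ≡⟨ +-inverseʳ (ι g) ⟨
    ι g - ι g                                ≡⟨ cong (_- ι g) (*-identityʳ (ι g)) ⟨
    ι g * 1ℚ - ι g                           ≡⟨ cong (λ x → ι g * x - ι g) 2Cβ≡1 ⟨
    ι g * ((C + C) * β) - ι g                ≡⟨ solve 3 (λ g C β → g :* ((C :+ C) :* β) :- g := β :* ((con 1ℚ :+ con 1ℚ) :* g :* C) :- g) refl (ι g) C β ⟩
    β * (ι 2 * ι g * C) - ι g                <⟨ +-monoˡ-< (- ι g) (*-monoʳ-<-pos β {{positive 0<β}} (constant-margin 1≤2g 0<r 0<δ r+δ≤ 1/Q<δ)) ⟩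
    β * (λ₀ * λ₀) - ι g                      ∎
    where open ≤-Reasoning

  -- J is chosen so that J γ exceeds the error 4 Q of the scale inequality, and
  -- T = Q (c + 1), a multiple of Q so that λ₀ ≤ harmonic T T, with T ≥ J β.
  frequently : ∃ λ n → suc m ℕ.≤ n × Fast a C n
  frequently =
    let J , 4Q<Jγ = exceeds {ι 4 * ι (suc m)} 0<γ
        c , Jβ≤c  = ≤ι (ι (suc J) * β)
    in [ id , (λ growth → ⊥-elim (absurd J c 4Q<Jγ Jβ≤c growth)) ]′
       (fast-or-bounded a C (suc m) (2 ℕ.^ (suc m ℕ.* suc c ℕ.+ suc m ℕ.* suc c)))
    where
    absurd : ∀ J c → ι 4 * ι (suc m) < ι (suc J) * γ → ι (suc J) * β ≤ ι c →
      (∀ n → suc m ℕ.≤ n → n ℕ.≤ 2 ℕ.^ (suc m ℕ.* suc c ℕ.+ suc m ℕ.* suc c) → ι (a (pred n)) ≤ allowance a C n) → ⊥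
    absurd J c 4Q<Jγ Jβ≤c growth = <-irrefl refl (begin-strict
      j * (β * (λ₀ * λ₀))                 ≤⟨ SingleScale.scale-inequality golomb enum (<⇒≤ 0<C) (<⇒≤ 0<β) 2Cβ≡1 m (suc m ℕ.* suc c) (suc J) ℕ.z<s
                                               (harmonic-diag-mult m (suc c)) (≤-trans Jβ≤c (ι-mono-≤ c≤T)) growth ⟩
      j * ι g + ι 4 * ι (suc m)           <⟨ +-monoʳ-< (j * ι g) 4Q<Jγ ⟩
      j * ι g + j * γ                     ≡⟨ solve 3 (λ j g x → j :* g :+ j :* (x :- g) := j :* x) refl j (ι g) (β * (λ₀ * λ₀)) ⟩
      j * (β * (λ₀ * λ₀))                 ∎)
      where
      open ≤-Reasoning
      j = ι (suc J)
      c≤T : c ℕ.≤ suc m ℕ.* suc c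
      c≤T = ℕ.≤-trans (ℕ.n≤1+n c) (ℕ.m≤n*m (suc c) (suc m))

module _ {g A a} .{{_ : NonZero g}} (golomb : IsGolombRuler g A) (enum : IsIncreasingEnumeration A a) where

  ratio-frequently : ∀ {q r} → 0ℚ < r → q < r → fromℚ r Defs.< log 2 ÷ (fromℕ 2 Defs.* fromℕ g) →
    ∀ N → ∃ λ k → fromℚ q Defs.< ratio a (N ℕ.+ k)
  ratio-frequently {q} {r} 0<r q<r r<log2/2g N =
    let δ , 0<δ , N₁ , r+δ≤ = ÷-upper (λ _ → refl) r<log2/2g
        N₂ , 1/N₂<δ         = archimedean δ 0<δ
    in at-scale δ 0<δ (suc N ℕ.⊔ (N₁ ℕ.⊔ N₂)) (ℕ.m≤m⊔n (suc N) (N₁ ℕ.⊔ N₂))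
         (≤-<-trans (1/suc-anti (ℕ.≤-trans (ℕ.m≤n⊔m N₁ N₂) (ℕ.m≤n⊔m (suc N) (N₁ ℕ.⊔ N₂)))) 1/N₂<δ)
         (r+δ≤ _ (ℕ.≤-trans (ℕ.m≤m⊔n N₁ N₂) (ℕ.m≤n⊔m (suc N) (N₁ ℕ.⊔ N₂))))
    where
    -- The n found is at least m + 1 ≥ N + 2, so it is a term of the N-th tail.
    at-scale : ∀ δ → 0ℚ < δ → ∀ m → suc N ℕ.≤ m → 1/suc m < δ → (r + δ) * (ι 2 * ι g) ≤ logSum 2 m →
      ∃ λ k → fromℚ q Defs.< ratio a (N ℕ.+ k)
    at-scale δ 0<δ m N<m 1/Q<δ r+δ≤ =
      let n , Q≤n , fast = frequently
          k , 2+N+k≡n    = ℕ.m≤n⇒∃[o]m+o≡n (ℕ.≤-trans (ℕ.s≤s N<m) Q≤n)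
      in k , fast⇒ratio a (N ℕ.+ k) q<r (<⇒≤ 0<r) (harmonic-diag-upper m)
               (subst (Fast a C) (sym 2+N+k≡n) fast)
      where
      open Frequently golomb enum 0<r 0<δ (ℕ.>-nonZero⁻¹ g) m 1/Q<δ
        (subst (λ l → (r + δ) * (ι 2 * ι g) ≤ harmonic (suc m) l) (ℕ.*-identityˡ (suc m)) r+δ≤)

-- The ratio is undefined at n = 1, where log n = 0; the limsup is taken over n = 2, 3, ….
corollary2 : (g : ℕ) → .{{_ : NonZero g}} → (A : Pred ℕ 0ℓ) (a : ℕ → ℕ) →
    IsGolombRuler g A → IsIncreasingEnumeration A a →
    fromℝ (log 2 ÷ (fromℕ 2 Defs.* fromℕ g)) Defs.≤
    limsup (λ k → let n = suc (suc k) in fromℕ (a (pred n)) ÷ (fromℕ n Defs.* fromℕ n Defs.* log n))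
corollary2 g A a golomb enum {q} q<X = by-sign (q <? 0ℚ)
  where
  X = fromℝ (log 2 ÷ (fromℕ 2 Defs.* fromℕ g))
  by-sign : Dec (q < 0ℚ) → Below (limsup (ratio a)) q
  -- The ratios are nonnegative.
  by-sign (yes q<0) = let r , q<r , r<0 = <-dense q<0 in r , q<r , λ N → 0 , ratio-nonneg a _ r<0
  -- Two rational steps above q: the ratios exceed r, and r′ leaves room for
  -- replacing log 2 by a rational.
  by-sign (no q≮0) =
    let r  , q<r  , r<X  = rounded X q<X
        r′ , r<r′ , r′<X = rounded X r<X
    in r , q<r , ratio-frequently golomb enum (≤-<-trans (≮⇒≥ q≮0) (<-trans q<r r<r′)) r<r′ r′<X
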